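{- Let $k\geq 3$ and $n\geq 1$ be integers. Let $\mathcal{S}_n(12\ldots k(k-1))$ denote the set of permutations of $[n]=\{1,\ldots,n\}$ avoiding the pattern $12\ldots (k-2)\,k\,(k-1)$, and $\mathcal{S}_n(23\ldots k1)$ the set of permutations of $[n]$ avoiding the pattern $23\ldots k\,1$. Then there exists a bijection $\Theta:\mathcal{S}_n(12\ldots k(k-1))\to \mathcal{S}_n(23\ldots k1)$ such that $\mathcal{D}(\Theta(\pi))=\mathcal{D}(\pi)$ for every $\pi\in \mathcal{S}_n(12\ldots k(k-1))$.
   Context: A permutation $\pi=\pi_1\cdots\pi_n$ contains a pattern $\tau=\tau_1\cdots\tau_k\in\mathcal{S}_k$ if some subsequence $\pi_{i_1}\cdots\pi_{i_k}$ ($i_1<\cdots<i_k$) is order-isomorphic to $\tau$; otherwise it avoids $\tau$. The pattern $12\ldots k(k-1)$ denotes the permutation $1\,2\,\cdots\,(k-2)\,k\,(k-1)$ of length $k$, and $23\ldots k1$ denotes $2\,3\,\cdots\,k\,1$. The descent set of $\pi$ is $\mathcal{D}(\pi)=\{i : \pi_i>\pi_{i+1}\}$. -}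

module Defs where

open import Data.Nat as ℕ using (ℕ; suc; _∸_)
open import Data.Fin as Fin using (Fin; toℕ)
open import Data.Vec using (Vec; lookup)
open import Data.Product using (Σ; _×_; ∃; proj₁)
open import Function.Definitions using (Injective)
open import Function.Bundles using (_⇔_)
open import Relation.Binary.PropositionalEquality using (_≡_)
open import Relation.Nullary using (¬_; yes; no)

-- A permutation of [n], in one-line notation: π = π₁ … πₙ stored as a
-- vector of length n with entries in Fin n (values 0..n-1 instead of 1..n;
-- only the relative order matters), all entries distinct.
IsPerm : (n : ℕ) → Vec (Fin n) n → Set
IsPerm n v = Injective _≡_ _≡_ (lookup v)

Perm : ℕ → Set
Perm n = Σ (Vec (Fin n) n) (IsPerm n)

Contains : {n k : ℕ} → Vec (Fin n) n → (Fin k → ℕ) → Set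
Contains {n} {k} v τ =
  Σ (Fin k → Fin n) λ e →
    (∀ a b → a Fin.< b → e a Fin.< e b) ×
    (∀ a b → (lookup v (e a) Fin.< lookup v (e b)) ⇔ (τ a ℕ.< τ b))

Avoids : {n k : ℕ} → Vec (Fin n) n → (Fin k → ℕ) → Set
Avoids v τ = ¬ Contains v τ

Av : (n : ℕ) {k : ℕ} → (Fin k → ℕ) → Set
Av n τ = Σ (Perm n) λ π → Avoids (proj₁ π) τ

pat12k : (k : ℕ) → Fin k → ℕ
pat12k k i with toℕ i ℕ.<? (k ∸ 2) | toℕ i ℕ.≟ (k ∸ 2)
... | yes _ | _ = suc (toℕ i)
... | no _ | yes _ = k
... | no _ | no _ = k ∸ 1

pat23k1 : (k : ℕ) → Fin k → ℕ
pat23k1 k i with toℕ i ℕ.<? (k ∸ 1)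
... | yes _ = suc (suc (toℕ i))
... | no _ = 1

-- i ∈ D(π) (positions 0-based: i is a descent iff π_i > π_{i+1}).
IsDescent : {n : ℕ} → Vec (Fin n) n → ℕ → Set
IsDescent {n} v i =
  Σ (Fin n) λ j → Σ (Fin n) λ j' →
    (toℕ j ≡ i) × (toℕ j' ≡ suc i) × (lookup v j' Fin.< lookup v j)

{-# OPTIONS --safe #-}
module Submission where

-- Read π as the word whose letters are the positions of its values: then i is a descent iff the letter
-- i + 1 comes before i when the values increase, and after i when they decrease. Let r = k − 2.
--
-- For 12…k(k−1) take the values in increasing order and row-insert the letters one by one. Avoidance means
-- that a letter lying above the end of an increasing subsequence of length r is the least unused letter
-- doing so. Such a letter is not inserted; instead the last unused position is marked, and the tableau is
-- cut there. Thus the top row never has more than r entries, and it has exactly r whenever a cut is made.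
--
-- For 23…k1 take the values in decreasing order. Avoidance means that no letter exceeds the top of a
-- decreasing subsequence of length r + 1. By Schensted's theorem the least such top is the first entry
-- of row r + 1, and as soon as an entry reaches that row it is marked and the tableau is cut there.
-- Thus there are never more than r rows, and exactly r whenever a cut is made.
--
-- In both cases the tableau, the rows where the insertions ended and the cuts form a closed marked walk
-- through partitions, from which the permutation can be recovered, and every such walk occurs. Transposing
-- the partitions exchanges the two kinds of walks. It also exchanges "i + 1 is in a lower row than i" with
-- its negation, which makes up for the opposite reading orders, so that descents are preserved.

open import Defs
open import Data.Nat
open import Data.Nat.Properties
open import Data.Fin as Fin using (Fin; toℕ; fromℕ<; opposite; punchOut)
import Data.Fin.Properties as Fin
open import Data.Vec as Vec using (Vec; []; _∷_; lookup; tabulate)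
open import Data.Vec.Properties using (lookup∘tabulate; tabulate∘lookup; tabulate-cong; lookup-map; map-∘; map-id; map-cong)
open import Data.List using (List; []; _∷_; map; replicate; length)
open import Data.List.Properties using (length-replicate)
open import Data.List.Membership.Propositional using (_∈_; _∉_)
open import Data.List.Membership.DecPropositional _≟_ using (_∈?_; _∉?_)
open import Data.List.Relation.Unary.Any using (here; there)
open import Data.Product using (Σ; _×_; _,_; proj₁; proj₂; ∃₂; Σ-syntax; ∃-syntax)
open import Data.Sum as Sum using (_⊎_; inj₁; inj₂)
open import Data.Empty using (⊥; ⊥-elim)
open import Data.Unit using (⊤; tt)
open import Relation.Nullary using (¬_; yes; no; Dec)
open import Relation.Nullary.Decidable using (_×-dec_; decidable-stable)
open import Relation.Binary.PropositionalEquality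
open import Relation.Binary.Definitions using (tri<; tri≈; tri>)
open import Function using (_∘_; id)
open import Function.Bundles using (_⇔_; mk⇔; Equivalence)
open import Function.Definitions using (Injective)

-- The walk is the border of a growth diagram in Fomin's sense: it follows the shapes of the tableau
-- restricted to its first y letters as y grows, and then the shapes of the past, backwards in time.
-- An insertion adds a row to the diagram, and a cut freezes the cells from the mark on. The local
-- rules are reversible, so the border alone determines the word. Transposition acts on borders
-- only; the two insertion processes need no relation beyond the fact that both produce all walks of
-- their kind. The processes differ in what a cut forgets. For 23...k1 the mark replaces the entry
-- that left the last permitted row, and the cells still show which letters are used. For
-- 12...k(k-1) the skipped letter is forced and need not be recorded; the mark goes to the last
-- blank instead, so that no blank is ever frozen. Past the point where the top row reaches r
-- entries the cells then show only how many letters are used, and the argument there rests on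
-- counting. The parameter `r₀` = r - 1 = k - 3 is the zero-based index of the last permitted row.

-- The i-th cell tells whether letter i is still unused, where a cut was made, or the row of i in the tableau
-- (row 0 being the top one).
data Cell : Set where
  blank mark : Cell
  row        : ℕ → Cell

-- The record of an insertion that lengthened row d, or of a cut.
data Step : Set where
  down : ℕ → Step
  jump : Step

Cells : Set
Cells = List Cell

data Filled : Cells → Set where
  []   : Filled []
  row  : ∀ {q L} → Filled L → Filled (row q ∷ L)
  mark : ∀ {L} → Filled L → Filled (mark ∷ L)

-- The invariant of both processes: a cut is made only when no blank lies behind it, so everything
-- that can still change lies before the first mark.
data Tidy : Cells → Set where
  []    : Tidy []
  blank : ∀ {L} → Tidy L → Tidy (blank ∷ L)
  row   : ∀ {q L} → Tidy L → Tidy (row q ∷ L)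
  mark  : ∀ {L} → Filled L → Tidy (mark ∷ L)

data Stop : Cells → Set where
  []   : Stop []
  mark : ∀ {L} → Stop (mark ∷ L)

-- Adding and removing boxes of a partition

inc : ℕ → (ℕ → ℕ) → ℕ → ℕ
inc q ρ x with x ≟ q
... | yes _ = suc (ρ x)
... | no  _ = ρ x

inc-≡ : ∀ q ρ → inc q ρ q ≡ suc (ρ q)
inc-≡ q ρ with q ≟ q
... | yes _ = refl
... | no ¬p = ⊥-elim (¬p refl)

inc-≢ : ∀ {q x} ρ → x ≢ q → inc q ρ x ≡ ρ x
inc-≢ {q} {x} ρ ne with x ≟ q
... | yes p = ⊥-elim (ne p)
... | no  _ = refl

inc-cong : ∀ q {ρ σ} → ρ ≗ σ → inc q ρ ≗ inc q σ
inc-cong q e x with x ≟ q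
... | yes _ = cong suc (e x)
... | no  _ = e x

inc-cancel : ∀ q {ρ σ} → inc q ρ ≗ inc q σ → ρ ≗ σ
inc-cancel q e x with x ≟ q | e x
... | yes _ | p = suc-injective p
... | no  _ | p = p

inc-comm : ∀ p q ρ → inc p (inc q ρ) ≗ inc q (inc p ρ)
inc-comm p q ρ x with x ≟ p in e₁ | x ≟ q in e₂
... | yes _ | yes _ rewrite e₁ | e₂ = refl
... | yes _ | no _  rewrite e₁ | e₂ = refl
... | no _  | yes _ rewrite e₁ | e₂ = refl
... | no _  | no _  rewrite e₁ | e₂ = refl

inc-≥ : ∀ q ρ x → ρ x ≤ inc q ρ x
inc-≥ q ρ x with x ≟ q
... | yes _ = n≤1+n _
... | no  _ = ≤-refl

dec : ℕ → (ℕ → ℕ) → ℕ → ℕ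
dec q ρ x with x ≟ q
... | yes _ = pred (ρ x)
... | no  _ = ρ x

inc-dec : ∀ q ρ → 0 < ρ q → ρ ≗ inc q (dec q ρ)
inc-dec q ρ pos x with x ≟ q in e
... | yes refl rewrite e = sym (suc-pred (ρ q) ⦃ >-nonZero pos ⦄)
... | no _     rewrite e = refl

Desc : (ℕ → ℕ) → Set
Desc ρ = ∀ x → ρ (suc x) ≤ ρ x

desc-cong : ∀ {ρ σ} → ρ ≗ σ → Desc ρ → Desc σ
desc-cong e d x = subst₂ _≤_ (e (suc x)) (e x) (d x)

desc-dec : ∀ {c ρ} → Desc ρ → ρ (suc c) < ρ c → Desc (dec c ρ)
desc-dec {c} {ρ} d l x with suc x ≟ c | x ≟ c
... | yes refl | yes p = ⊥-elim (1+n≢n (sym p))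
... | yes refl | no  _ = ≤-trans pred[n]≤n (d x)
... | no  _ | yes refl = <⇒≤pred l
... | no  _ | no  _    = d x

desc-hit : ∀ {c ρ} → Desc ρ → Desc (inc c ρ) → Desc (inc (suc c) (inc c ρ))
desc-hit {c} {ρ} d e x with suc x ≟ suc c | x ≟ suc c
... | yes p | yes refl = ⊥-elim (1+n≢n p)
... | yes refl | no _ rewrite inc-≡ c ρ | inc-≢ {c} {suc c} ρ 1+n≢n = s≤s (d c)
... | no ne | yes refl = ≤-trans (e x) (n≤1+n _)
... | no ne | no _ = e x

desc-pass : ∀ {c q ρ} → q ≢ c → Desc (inc c ρ) → Desc (inc q ρ) → Desc (inc q (inc c ρ))
desc-pass {c} {q} {ρ} ne d e x with suc x ≟ q | x ≟ q
... | yes refl | yes p = ⊥-elim (1+n≢n (sym p))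
... | no _ | yes refl = ≤-trans (d x) (n≤1+n _)
... | no _ | no _ = d x
... | yes refl | no _ with e x
... | ex rewrite inc-≡ (suc x) ρ | inc-≢ {c} {suc x} ρ ne
      | inc-≢ {suc x} {x} ρ (1+n≢n ∘ sym) = ≤-trans ex (inc-≥ c ρ x)

-- Row insertion as a single scan: reversibility, determinism, totality

-- Row insertion of a letter s turns cell s into row 0 and scans the larger letters with a carry, the row into
-- which the next letter has to be bumped: a letter of row c meeting the carry c moves to row c + 1.
data Base (r₀ : ℕ) : Step → ℕ → Cells → Cells → Set where
  stay : ∀ {d L} → Stop L → Base r₀ (down d) d L L
  cut  : ∀ {h} → Filled h → Base r₀ jump r₀ (row r₀ ∷ h) (mark ∷ h)

data Bump (r₀ : ℕ) (p : Step) : ℕ → Cells → Cells → Set where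
  base : ∀ {c L L'} → Base r₀ p c L L' → Bump r₀ p c L L'
  skip : ∀ {c L L'} → Bump r₀ p c L L' → Bump r₀ p c (blank ∷ L) (blank ∷ L')
  hit  : ∀ {c L L'} → Bump r₀ p (suc c) L L' → Bump r₀ p c (row c ∷ L) (row (suc c) ∷ L')
  pass : ∀ {c q L L'} → q ≢ c → Bump r₀ p c L L' → Bump r₀ p c (row q ∷ L) (row q ∷ L')

data Ins (r₀ : ℕ) (p : Step) : ℕ → Cells → Cells → Set where
  here  : ∀ {L L'} → Bump r₀ p 0 L L' → Ins r₀ p 0 (blank ∷ L) (row 0 ∷ L')
  blank : ∀ {s L L'} → Ins r₀ p s L L' → Ins r₀ p (suc s) (blank ∷ L) (blank ∷ L')
  row   : ∀ {q s L L'} → Ins r₀ p s L L' → Ins r₀ p (suc s) (row q ∷ L) (row q ∷ L')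

-- The carry with which the scan ends; carries only grow, so it bounds all of them.
lim : ℕ → Step → ℕ
lim r₀ (down d) = d
lim r₀ jump     = r₀

bump-lim : ∀ {r₀ p c L L'} → Bump r₀ p c L L' → c ≤ lim r₀ p
bump-lim (base (stay _)) = ≤-refl
bump-lim (base (cut _))  = ≤-refl
bump-lim (skip b)   = bump-lim b
bump-lim (hit b)    = ≤-trans (n≤1+n _) (bump-lim b)
bump-lim (pass _ b) = bump-lim b

-- Reverse bumping. The step fixes the final carry; read from the right, a cell in the row of the
-- current carry must have been hit, since `pass` excludes that row, and every other row was passed.
bump-inj : ∀ {r₀ p c₁ c₂ L₁ L₂ L'} → Bump r₀ p c₁ L₁ L' → Bump r₀ p c₂ L₂ L' → c₁ ≡ c₂ × L₁ ≡ L₂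
bump-inj (base (stay _)) (base (stay _)) = refl , refl
bump-inj (base (cut _)) (base (cut _)) = refl , refl
bump-inj (base (stay ())) (skip b)
bump-inj (base (stay ())) (hit b)
bump-inj (base (stay ())) (pass x b)
bump-inj (skip a) (base (stay ()))
bump-inj (skip a) (skip b) with bump-inj a b
... | refl , refl = refl , refl
bump-inj (hit a) (base (stay ()))
bump-inj (hit a) (hit b) with bump-inj a b
... | refl , refl = refl , refl
bump-inj (hit a) (pass x b) with bump-inj a b
... | refl , refl = ⊥-elim (x refl)
bump-inj (pass x a) (base (stay ()))
bump-inj (pass x a) (hit b) with bump-inj a b
... | refl , refl = ⊥-elim (x refl)
bump-inj (pass _ a) (pass _ b) with bump-inj a b
... | refl , refl = refl , refl

-- The reverse scan is over at the first `row 0` that meets carry 0: `pass` forbids it and `hit`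
-- never produces it. So the result itself tells where the insertion began.
bump-ins-⊥ : ∀ {r₀ p c s L₁ L₂ L'} → Bump r₀ p c L₁ L' → Ins r₀ p s L₂ L' → ⊥
bump-ins-⊥ (base (stay ())) (here _)
bump-ins-⊥ (base (stay ())) (blank _)
bump-ins-⊥ (base (stay ())) (row _)
bump-ins-⊥ (skip a) (blank i) = bump-ins-⊥ a i
bump-ins-⊥ (hit a) (row i) = bump-ins-⊥ a i
bump-ins-⊥ (pass _ a) (row i) = bump-ins-⊥ a i
bump-ins-⊥ (pass x a) (here b) with bump-inj a b
... | refl , refl = x refl

ins-inj : ∀ {r₀ p s₁ s₂ L₁ L₂ L'} → Ins r₀ p s₁ L₁ L' → Ins r₀ p s₂ L₂ L' → s₁ ≡ s₂ × L₁ ≡ L₂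
ins-inj (here a) (here b) with bump-inj a b
... | refl , refl = refl , refl
ins-inj (here a) (row j) = ⊥-elim (bump-ins-⊥ a j)
ins-inj (row i) (here b) = ⊥-elim (bump-ins-⊥ b i)
ins-inj (blank i) (blank j) with ins-inj i j
... | refl , refl = refl , refl
ins-inj (row i) (row j) with ins-inj i j
... | refl , refl = refl , refl

-- Under this condition the step is determined by the insertion: the carry r₀ meeting row r₀ has to be a cut.
Short : ℕ → Step → Set
Short r₀ p = p ≡ jump ⊎ (∃[ d ] p ≡ down d × d ≤ r₀)

short-lim : ∀ {r₀ p} → Short r₀ p → lim r₀ p ≤ r₀
short-lim (inj₁ refl) = ≤-refl
short-lim (inj₂ (d , refl , l)) = l

bump-det : ∀ {r₀ p₁ p₂ c L L₁ L₂} → Short r₀ p₁ → Short r₀ p₂ →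
           Bump r₀ p₁ c L L₁ → Bump r₀ p₂ c L L₂ → p₁ ≡ p₂ × L₁ ≡ L₂
bump-det s t (base (stay _)) (base (stay _)) = refl , refl
bump-det s t (base (cut _)) (base (cut _)) = refl , refl
bump-det s t (base (stay ())) (base (cut _))
bump-det s t (base (cut _)) (base (stay ()))
bump-det s t (base (stay ())) (skip b)
bump-det s t (base (stay ())) (hit b)
bump-det s t (base (stay ())) (pass x b)
bump-det s t (base (cut _)) (hit b) = ⊥-elim (<-irrefl refl (≤-trans (bump-lim b) (short-lim t)))
bump-det s t (base (cut _)) (pass x b) = ⊥-elim (x refl)
bump-det s t (skip a) (base (stay ()))
bump-det s t (skip a) (skip b) with bump-det s t a b
... | refl , refl = refl , refl
bump-det s t (hit a) (base (stay ()))
bump-det s t (hit a) (base (cut _)) = ⊥-elim (<-irrefl refl (≤-trans (bump-lim a) (short-lim s)))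
bump-det s t (hit a) (hit b) with bump-det s t a b
... | refl , refl = refl , refl
bump-det s t (hit a) (pass x b) = ⊥-elim (x refl)
bump-det s t (pass x a) (base (stay ()))
bump-det s t (pass x a) (base (cut _)) = ⊥-elim (x refl)
bump-det s t (pass x a) (hit b) = ⊥-elim (x refl)
bump-det s t (pass _ a) (pass _ b) with bump-det s t a b
... | refl , refl = refl , refl

ins-det : ∀ {r₀ p₁ p₂ s L L₁ L₂} → Short r₀ p₁ → Short r₀ p₂ →
          Ins r₀ p₁ s L L₁ → Ins r₀ p₂ s L L₂ → p₁ ≡ p₂ × L₁ ≡ L₂
ins-det s t (here a) (here b) with bump-det s t a b
... | refl , refl = refl , refl
ins-det s t (blank a) (blank b) with ins-det s t a b
... | refl , refl = refl , refl
ins-det s t (row a) (row b) with ins-det s t a b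
... | refl , refl = refl , refl

-- For 12...k(k-1) the number of rows is not bounded and `Short` is not at hand; without cuts,
-- however, each cell admits only one rule.
bump-down-det : ∀ {r₀ d₁ d₂ c L L₁ L₂} →
           Bump r₀ (down d₁) c L L₁ → Bump r₀ (down d₂) c L L₂ → d₁ ≡ d₂ × L₁ ≡ L₂
bump-down-det (base (stay _)) (base (stay _)) = refl , refl
bump-down-det (base (stay ())) (skip b)
bump-down-det (base (stay ())) (hit b)
bump-down-det (base (stay ())) (pass x b)
bump-down-det (skip a) (base (stay ()))
bump-down-det (skip a) (skip b) with bump-down-det a b
... | refl , refl = refl , refl
bump-down-det (hit a) (base (stay ()))
bump-down-det (hit a) (hit b) with bump-down-det a b
... | refl , refl = refl , refl
bump-down-det (hit a) (pass x b) = ⊥-elim (x refl)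
bump-down-det (pass x a) (base (stay ()))
bump-down-det (pass x a) (hit b) = ⊥-elim (x refl)
bump-down-det (pass _ a) (pass _ b) with bump-down-det a b
... | refl , refl = refl , refl

ins-down-det : ∀ {r₀ d₁ d₂ s L L₁ L₂} →
           Ins r₀ (down d₁) s L L₁ → Ins r₀ (down d₂) s L L₂ → d₁ ≡ d₂ × L₁ ≡ L₂
ins-down-det (here a) (here b) with bump-down-det a b
... | refl , refl = refl , refl
ins-down-det (blank a) (blank b) with ins-down-det a b
... | refl , refl = refl , refl
ins-down-det (row a) (row b) with ins-down-det a b
... | refl , refl = refl , refl

bump-total : ∀ r₀ c L → ∃₂ λ d L' → Bump r₀ (down d) c L L'
bump-total r₀ c [] = c , [] , base (stay [])
bump-total r₀ c (mark ∷ L) = c , mark ∷ L , base (stay mark)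
bump-total r₀ c (blank ∷ L) with bump-total r₀ c L
... | d , L' , b = d , blank ∷ L' , skip b
bump-total r₀ c (row q ∷ L) with q ≟ c
... | no ne with bump-total r₀ c L
...   | d , L' , b = d , row q ∷ L' , pass ne b
bump-total r₀ c (row q ∷ L) | yes refl with bump-total r₀ (suc c) L
...   | d , L' , b = d , row (suc c) ∷ L' , hit b

data Free : ℕ → Cells → Set where
  here  : ∀ {L} → Free 0 (blank ∷ L)
  blank : ∀ {s L} → Free s L → Free (suc s) (blank ∷ L)
  row   : ∀ {q s L} → Free s L → Free (suc s) (row q ∷ L)

ins-total : ∀ r₀ {s L} → Free s L → ∃₂ λ d L' → Ins r₀ (down d) s L L'
ins-total r₀ {L = _ ∷ L} here with bump-total r₀ 0 L
... | d , L' , b = d , row 0 ∷ L' , here b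
ins-total r₀ (blank f) with ins-total r₀ f
... | d , L' , i = d , blank ∷ L' , blank i
ins-total r₀ (row {q} f) with ins-total r₀ f
... | d , L' , i = d , row q ∷ L' , row i

-- Marked walks, and insertion as a local change of them

record Shape (i b : ℕ) (ρ : ℕ → ℕ) : Set where
  constructor _,_
  field
    desc  : Desc ρ
    bound : ρ i ≤ b
open Shape

shape-cong : ∀ {i b ρ σ} → ρ ≗ σ → Shape i b ρ → Shape i b σ
shape-cong {i} {b} e (d , l) = desc-cong e d , subst (_≤ b) (e i) l

-- V i b j m ρ L ps : reading the rows of L up to a mark (or the end) as boxes added to ρ, then the
-- steps of ps up to a jump as boxes removed, then L from the mark on, and so on, visits only
-- partitions whose part i is at most b, meets marks only when part j exceeds m, and ends at ∅.
data V (i b j m : ℕ) : (ℕ → ℕ) → Cells → List Step → Set where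
  blank : ∀ {ρ L ps} → V i b j m ρ L ps → V i b j m ρ (blank ∷ L) ps
  row   : ∀ {q ρ L ps} → Shape i b (inc q ρ) → V i b j m (inc q ρ) L ps → V i b j m ρ (row q ∷ L) ps
  down  : ∀ {d ρ ρ' L ps} → Stop L → ρ ≗ inc d ρ' → Shape i b ρ' → V i b j m ρ' L ps → V i b j m ρ L (down d ∷ ps)
  jump  : ∀ {ρ L ps} → m < ρ j → V i b j m ρ L ps → V i b j m ρ (mark ∷ L) (jump ∷ ps)
  end   : ∀ {ρ} → (∀ x → ρ x ≡ 0) → V i b j m ρ [] []

V-cong : ∀ {i b j m ρ σ L ps} → ρ ≗ σ → V i b j m ρ L ps → V i b j m σ L ps
V-cong e (blank v) = blank (V-cong e v)
V-cong e (row {q} s v) = row (shape-cong (inc-cong q e) s) (V-cong (inc-cong q e) v)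
V-cong e (down st e' s v) = down st (λ x → trans (sym (e x)) (e' x)) s v
V-cong {m = m} e (jump l v) = jump (subst (m <_) (e _) l) (V-cong e v)
V-cong e (end z) = end (λ x → trans (sym (e x)) (z x))

shape-hit : ∀ {i b c ρ} → i ≢ suc c → Shape i b ρ → Shape i b (inc c ρ) → Shape i b (inc (suc c) (inc c ρ))
shape-hit {i} {b} {c} {ρ} ne (d , _) (d' , l') = desc-hit d d' , subst (_≤ b) (sym (inc-≢ (inc c ρ) ne)) l'

shape-pass : ∀ {i b c q ρ} → q ≢ c → Shape i b (inc c ρ) → Shape i b (inc q ρ) → Shape i b (inc q (inc c ρ))
shape-pass {i} {b} {c} {q} {ρ} ne (d , l) (d' , l') = desc-pass ne d d' , go
  where
  go : inc q (inc c ρ) i ≤ b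
  go with i ≟ q
  ... | no _ = l
  ... | yes refl = subst (λ x → suc x ≤ b) (sym (inc-≢ ρ ne)) l'

module _ {i b j m : ℕ} where

  -- Fomin's local rule: the old and the new walk run side by side, and the new one is ahead by one
  -- box in the row of the carry. When the old walk adds that very box, the new one adds a box one
  -- row lower. The first hypothesis keeps these lower boxes out of row i; the second makes a cut
  -- legal.
  bump-fwd : ∀ {r₀ p c ρ L L' ps} → i ≡ 0 ⊎ lim r₀ p < i → (∀ σ → p ≡ jump → m < inc r₀ σ j) →
             Shape i b ρ → Shape i b (inc c ρ) → V i b j m ρ L ps → Bump r₀ p c L L' →
             V i b j m (inc c ρ) L' (p ∷ ps)
  bump-fwd i≤ J s s' v (base (stay st)) = down st (λ _ → refl) s v
  -- The box that the old walk adds at this cell is the one by which the new walk is ahead, so the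
  -- new walk may stand still at the mark.
  bump-fwd i≤ J s s' (row _ v) (base (cut _)) = jump (J _ refl) v
  bump-fwd i≤ J s s' (blank v) (skip bp) = blank (bump-fwd i≤ J s s' v bp)
  bump-fwd {r₀ = r₀} {p} {c} i≤ J s s' (row {q = .c} t v) (hit bp) = row s″ (bump-fwd i≤ J t s″ v bp)
    where
    ne : i ≡ 0 ⊎ lim r₀ p < i → i ≢ suc c
    ne (inj₁ refl) ()
    ne (inj₂ l) refl = <-irrefl refl (≤-trans l (bump-lim bp))
    s″ = shape-hit (ne i≤) s s'
  bump-fwd {c = c} {ρ} i≤ J s s' (row {q = q} t v) (pass ne bp) =
    row s″ (V-cong (inc-comm c q ρ) (bump-fwd i≤ J t (shape-cong (inc-comm q c ρ) s″) v bp))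
    where
    s″ = shape-pass ne s' t

  -- The local rule read backwards, from the far end of the scan: either the new walk is still ahead
  -- here by a box in some row c, or the inserted letter lies further on and both walks agree here.
  bump-back : ∀ {r₀ p ρ' L' ps} →
    (∀ {σ} → p ≡ jump → Shape i b σ → m < σ j → ∃[ ρ ] σ ≗ inc r₀ ρ × Shape i b ρ) →
    Tidy L' → Shape i b ρ' → V i b j m ρ' L' (p ∷ ps) →
    (∃₂ λ c L → ∃[ ρ ] Bump r₀ p c L L' × ρ' ≗ inc c ρ × Shape i b ρ × V i b j m ρ L ps)
    ⊎ (∃₂ λ s L → Ins r₀ p s L L' × V i b j m ρ' L ps)
  bump-back J t s (down st e s₁ v) = inj₁ (_ , _ , _ , base (stay st) , e , s₁ , v)
  bump-back J (mark f) s (jump l v) with J refl s l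
  ... | ρ , e , s₁ = inj₁ (_ , _ , ρ , base (cut f) , e , s₁ , row (shape-cong e s) (V-cong e v))
  bump-back J (blank t) s (blank v) with bump-back J t s v
  ... | inj₁ (c , L , ρ , bp , e , s₁ , v₁) = inj₁ (c , _ , ρ , skip bp , e , s₁ , blank v₁)
  ... | inj₂ (x , L , is , v₁) = inj₂ (_ , _ , blank is , blank v₁)
  bump-back {ρ' = ρ'} J (row t) s (row {q = q} s′ v) with bump-back J t s′ v
  ... | inj₂ (x , L , is , v₁) = inj₂ (_ , _ , row is , row s′ v₁)
  ... | inj₁ (c , L , ρ₁ , bp , e , s₁ , v₁) with q ≟ c
  ...   | yes refl with q
  -- The box by which the new walk is ahead was added at this very cell in the top row: this is the
  -- inserted letter.
  ...     | zero = inj₂ (0 , _ , here bp , blank (V-cong (λ x → sym (inc-cancel 0 e x)) v₁))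
  -- The cell was hit, so before it the extra box lay one row higher; that row ends in a corner
  -- because a box can be added below its end.
  ...     | suc c₀ = inj₁ (c₀ , _ , dec c₀ ρ' , hit bp , eq , s₂ ,
                       row (shape-cong eq s) (V-cong (λ x → trans (sym (inc-cancel (suc c₀) e x)) (eq x)) v₁))
    where
    below : ρ' (suc c₀) < ρ' c₀
    below = subst₂ _≤_ (inc-≡ (suc c₀) ρ') (inc-≢ {suc c₀} {c₀} ρ' (1+n≢n ∘ sym)) (desc s′ c₀)
    eq : ρ' ≗ inc c₀ (dec c₀ ρ')
    eq = inc-dec c₀ ρ' (≤-<-trans z≤n below)
    s₂ : Shape i b (dec c₀ ρ')
    s₂ = desc-dec (desc s) below , ≤-trans (subst (dec c₀ ρ' i ≤_) (sym (eq i)) (inc-≥ c₀ (dec c₀ ρ') i)) (bound s)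
  bump-back {ρ' = ρ'} J (row t) s (row {q = q} s′ v)
    | inj₁ (c , L , ρ₁ , bp , e , s₁ , v₁) | no ne =
    inj₁ (c , _ , ρ , pass ne bp , eq , s₂ , row (shape-cong ρ₁≗ s₁) (V-cong ρ₁≗ v₁))
    where
    ρ = dec c ρ'
    ρ'c : ρ' c ≡ suc (ρ₁ c)
    ρ'c = trans (sym (inc-≢ ρ' (ne ∘ sym))) (trans (e c) (inc-≡ c ρ₁))
    eq : ρ' ≗ inc c ρ
    eq = inc-dec c ρ' (subst (0 <_) (sym ρ'c) z<s)
    ρ₁≗ : ρ₁ ≗ inc q ρ
    ρ₁≗ = inc-cancel c λ x → trans (sym (e x)) (trans (inc-cong q eq x) (inc-comm q c ρ x))
    below : ρ' (suc c) < ρ' c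
    below = subst (ρ' (suc c) <_) (sym ρ'c) (s≤s (≤-trans
      (subst (ρ' (suc c) ≤_) (trans (e (suc c)) (inc-≢ ρ₁ 1+n≢n)) (inc-≥ q ρ' (suc c)))
      (desc s₁ c)))
    s₂ : Shape i b ρ
    s₂ = desc-dec (desc s) below , ≤-trans (subst (ρ i ≤_) (sym (eq i)) (inc-≥ c ρ i)) (bound s)

-- The number of entries of the top row among the first y letters, up to the first mark.
N : Cells → ℕ → ℕ
N []                y       = 0
N (mark ∷ L)        y       = 0
N (blank ∷ L)       zero    = 0
N (blank ∷ L)       (suc y) = N L y
N (row q ∷ L)       zero    = 0
N (row zero ∷ L)    (suc y) = suc (N L y)
N (row (suc q) ∷ L) (suc y) = N L y

N-row : ∀ q ρ L s → inc q ρ 0 + N L s ≡ ρ 0 + N (row q ∷ L) (suc s)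
N-row zero    ρ L s = sym (+-suc (ρ 0) (N L s))
N-row (suc q) ρ L s = refl

shape-0 : ∀ {i b ρ} → (i ≡ 0 → ρ 0 < b) → Shape i b ρ → Shape i b (inc 0 ρ)
shape-0 {i} {b} {ρ} h (d , l) = desc₀ , bound₀ i h l
  where
  desc₀ : Desc (inc 0 ρ)
  desc₀ zero    = ≤-trans (d 0) (n≤1+n _)
  desc₀ (suc x) = d (suc x)
  bound₀ : ∀ i → (i ≡ 0 → ρ 0 < b) → ρ i ≤ b → inc 0 ρ i ≤ b
  bound₀ zero    h l = h refl
  bound₀ (suc i) h l = l

module _ {i b j m : ℕ} where

  -- When the walk reaches letter s its top part is `ρ 0 + N L s`, and the new letter adds one box
  -- there. This matters only if the bounded part is the top one.
  ins-fwd : ∀ {r₀ p s ρ L L' ps} → i ≡ 0 ⊎ lim r₀ p < i → (∀ σ → p ≡ jump → m < inc r₀ σ j) →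
            (i ≡ 0 → ρ 0 + N L s < b) → Shape i b ρ →
            V i b j m ρ L ps → Ins r₀ p s L L' → V i b j m ρ L' (p ∷ ps)
  ins-fwd {ρ = ρ} i≤ J h sh (blank v) (here bp) = row sh' (bump-fwd i≤ J sh sh' v bp)
    where
    sh' = shape-0 (λ e → subst (_< b) (+-identityʳ (ρ 0)) (h e)) sh
  ins-fwd i≤ J h sh (blank v) (blank is) = blank (ins-fwd i≤ J h sh v is)
  ins-fwd {s = suc s} {ρ} {L = _ ∷ L} i≤ J h sh (row {q} sh' v) (row is) =
    row sh' (ins-fwd i≤ J (λ e → subst (_< b) (sym (N-row q ρ L s)) (h e)) sh' v is)

  ins-back : ∀ {r₀ p L' ps} →
    (∀ {σ} → p ≡ jump → Shape i b σ → m < σ j → ∃[ ρ ] σ ≗ inc r₀ ρ × Shape i b ρ) →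
    Tidy L' → V i b j m (λ _ → 0) L' (p ∷ ps) →
    ∃₂ λ s L → Ins r₀ p s L L' × V i b j m (λ _ → 0) L ps
  ins-back J t v with bump-back J t ((λ _ → z≤n) , z≤n) v
  ... | inj₂ r = r
  ... | inj₁ (c , _ , ρ , _ , e , _) with trans (e c) (inc-≡ c ρ)
  -- The walk starts at the empty partition, which has no box to be ahead by, so the reverse scan
  -- must have ended.
  ...   | ()

-- Recovers from the walk the condition under which a letter is inserted rather than skipped.
low-bound : ∀ {b j m r₀ p s ρ L L' ps} → V 0 b j m ρ L' ps → Ins r₀ p s L L' → ρ 0 + N L s < b
low-bound {b} {ρ = ρ} (row sh v) (here _) = subst (_< b) (sym (+-identityʳ (ρ 0))) (bound sh)
low-bound (blank v) (blank is) = low-bound v is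
low-bound {b} {s = suc s} {ρ} {L = row q ∷ L} (row sh v) (row is) =
  subst (_< b) (N-row q ρ L s) (low-bound v is)

-- Transposing walks and comparing descents

-- Row lengths ρ and column lengths γ of the same partition.
Conj : (ℕ → ℕ) → (ℕ → ℕ) → Set
Conj ρ γ = ∀ q c → (c < ρ q → q < γ c) × (q < γ c → c < ρ q)

conj-sym : ∀ {ρ γ} → Conj ρ γ → Conj γ ρ
conj-sym k q c = proj₂ (k c q) , proj₁ (k c q)

conj-inc : ∀ {ρ γ q c} → c ≡ ρ q → q ≡ γ c → Conj ρ γ → Conj (inc q ρ) (inc c γ)
conj-inc e₁ e₂ k q c = half e₁ e₂ k q c , half e₂ e₁ (conj-sym k) c q
  where
  half : ∀ {ρ γ q c} → c ≡ ρ q → q ≡ γ c → Conj ρ γ → ∀ x y → y < inc q ρ x → x < inc c γ y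
  half {ρ} {γ} {q} {c} e₁ e₂ k x y l with x ≟ q | y ≟ c
  ... | yes refl | yes refl = s≤s (≤-reflexive e₂)
  ... | yes refl | no ne = proj₁ (k x y) (subst (y <_) e₁ (≤∧≢⇒< (subst (y ≤_) (sym e₁) (s≤s⁻¹ l)) ne))
  ... | no _ | yes refl = m≤n⇒m≤1+n (proj₁ (k x y) l)
  ... | no _ | no _ = proj₁ (k x y) l

desc-mono : ∀ {ρ} → Desc ρ → ∀ {x y} → x ≤ y → ρ y ≤ ρ x
desc-mono {ρ} d {x} l with ≤⇒≤′ l
... | l′ = go l′
  where
  go : ∀ {y} → x ≤′ y → ρ y ≤ ρ x
  go ≤′-refl = ≤-refl
  go (≤′-step l) = ≤-trans (d _) (go l)

-- If a box can be added to row q, then all rows above are longer than row q, so the column of the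
-- new box holds exactly q boxes.
conj-corner : ∀ {ρ γ} q → Conj ρ γ → Desc (inc q ρ) → q ≡ γ (ρ q)
conj-corner {ρ} {γ} q k d = ≤-antisym (up q refl) (≮⇒≥ λ l → <-irrefl refl (proj₂ (k q (ρ q)) l))
  where
  up : ∀ x → x ≡ q → x ≤ γ (ρ q)
  up zero e = z≤n
  up (suc x) refl = proj₁ (k x (ρ q)) (subst₂ _≤_ (inc-≡ q ρ) (inc-≢ {q} {x} ρ (1+n≢n ∘ sym)) (d x))

conj-down : ∀ {ρ ρ' γ} q → ρ ≗ inc q ρ' → Desc ρ' → Conj ρ γ →
            ∃[ γ' ] γ ≗ inc (ρ' q) γ' × q ≡ γ' (ρ' q) × Conj ρ' γ'
conj-down {ρ} {ρ'} {γ} q e d k = γ' , eq , sym γ'c , λ x y → fwd x y , bwd x y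
  where
  c = ρ' q
  γ' = dec c γ
  ρq : ρ q ≡ suc c
  ρq = trans (e q) (inc-≡ q ρ')
  γc : γ c ≡ suc q
  γc = ≤-antisym
    (≮⇒≥ λ l → <-irrefl refl (<-≤-trans (subst (c <_) (trans (e (suc q)) (inc-≢ ρ' 1+n≢n)) (proj₂ (k (suc q) c) l)) (d q)))
    (proj₁ (k q c) (subst (c <_) (sym ρq) ≤-refl))
  eq : γ ≗ inc c γ'
  eq = inc-dec c γ (subst (0 <_) (sym γc) z<s)
  γ'c : γ' c ≡ q
  γ'c = suc-injective (trans (sym (inc-≡ c γ')) (trans (sym (eq c)) γc))
  fwd : ∀ x y → y < ρ' x → x < γ' y
  fwd x y l with y ≟ c
  ... | yes refl = subst (x <_) (sym (cong pred γc)) (≰⇒> λ q≤x → <-irrefl refl (<-≤-trans l (desc-mono d q≤x)))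
  ... | no _ = proj₁ (k x y) (<-≤-trans l (subst (ρ' x ≤_) (sym (e x)) (inc-≥ q ρ' x)))
  bwd : ∀ x y → x < γ' y → y < ρ' x
  bwd x y l with proj₂ (k x y) (<-≤-trans l (subst (γ' y ≤_) (sym (eq y)) (inc-≥ c γ' y))) | x ≟ q
  ... | l' | no ne = subst (y <_) (trans (e x) (inc-≢ ρ' ne)) l'
  ... | l' | yes refl = ≤∧≢⇒< (s≤s⁻¹ (subst (y <_) ρq l')) λ { refl → <-irrefl (sym γ'c) l }

conj-desc : ∀ {ρ γ} → Conj ρ γ → Desc ρ → Desc γ
conj-desc {ρ} {γ} k d x = ≮⇒≥ λ l → <-irrefl refl (proj₁ (k (γ x) x) (<-trans (n<1+n x) (proj₂ (k (γ x) (suc x)) l)))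

conj-shape : ∀ {i b ρ γ} → Conj ρ γ → Shape i b ρ → Shape b i γ
conj-shape {i} {b} k (d , l) = conj-desc k d , ≮⇒≥ λ l' → <-irrefl refl (<-≤-trans (proj₂ (k i b) l') l)

-- A relation rather than a function: each box carries both coordinates, which makes `Tr` symmetric,
-- and `tr-det` then serves both directions.
data Tr : (ℕ → ℕ) → (ℕ → ℕ) → Cells → List Step → Cells → List Step → Set where
  row  : ∀ {ρ γ q c L L' ps ps'} → c ≡ ρ q → q ≡ γ c →
         Tr (inc q ρ) (inc c γ) L ps L' ps' → Tr ρ γ (row q ∷ L) ps (row c ∷ L') ps'
  down : ∀ {ρ γ ρ' γ' q c L L' ps ps'} → Stop L → Stop L' → ρ ≗ inc q ρ' → γ ≗ inc c γ' →
         c ≡ ρ' q → q ≡ γ' c → Conj ρ' γ' →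
         Tr ρ' γ' L ps L' ps' → Tr ρ γ L (down q ∷ ps) L' (down c ∷ ps')
  jump : ∀ {ρ γ L L' ps ps'} → Tr ρ γ L ps L' ps' → Tr ρ γ (mark ∷ L) (jump ∷ ps) (mark ∷ L') (jump ∷ ps')
  end  : ∀ {ρ γ} → Tr ρ γ [] [] [] []

tr-sym : ∀ {ρ γ L ps L' ps'} → Tr ρ γ L ps L' ps' → Tr γ ρ L' ps' L ps
tr-sym (row e₁ e₂ t) = row e₂ e₁ (tr-sym t)
tr-sym (down s s' e e' e₁ e₂ k t) = down s' s e' e e₂ e₁ (conj-sym k) (tr-sym t)
tr-sym (jump t) = jump (tr-sym t)
tr-sym end = end

tr-det : ∀ {ρ γ ρ₁ γ₁ L ps L' L₁ ps' ps₁} → ρ ≗ ρ₁ →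
         Tr ρ γ L ps L' ps' → Tr ρ₁ γ₁ L ps L₁ ps₁ → L' ≡ L₁ × ps' ≡ ps₁
tr-det e (row {q = q} refl _ t) (row refl _ t₁) with tr-det (inc-cong q e) t t₁
... | refl , refl = cong (λ x → row x ∷ _) (e q) , refl
tr-det e (row _ _ t) (down () _ _ _ _ _ _ _)
tr-det e (down () _ _ _ _ _ _ _) (row _ _ t)
tr-det e (down {q = q} _ _ e₁ _ refl _ _ t) (down _ _ e₂ _ refl _ _ t₁)
  with inc-cancel q (λ x → trans (sym (e₁ x)) (trans (e x) (e₂ x)))
... | e' with tr-det e' t t₁
...   | refl , refl = refl , cong (λ x → down x ∷ _) (e' q)
tr-det e (jump t) (jump t₁) with tr-det e t t₁
... | refl , refl = refl , refl
tr-det e end end = refl , refl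

-- Part i is at most b exactly when column b is at most i, and part j exceeds m exactly when column
-- m exceeds j. This is why the parameters swap in pairs.
tr-exists : ∀ {i b j m ρ γ L ps} → Filled L → Conj ρ γ → V i b j m ρ L ps →
            ∃₂ λ L' ps' → Tr ρ γ L ps L' ps' × V b i m j γ L' ps' × Filled L'
tr-exists {ρ = ρ} (row f) k (row {q = q} s v) with conj-corner q k (desc s)
... | e with conj-inc refl e k
...   | k' with tr-exists f k' v
...     | L' , ps' , t , v' , f' =
  row (ρ q) ∷ L' , ps' , row refl e t , row (conj-shape k' s) v' , row f'
tr-exists f k (down {d = d} st e s v) with conj-down d e (desc s) k
... | γ' , e' , e₂ , k' with tr-exists f k' v
...   | L' , ps' , t , v' , f' =
  L' , _ , down st (stop st t) e e' refl e₂ k' t , down (stop st t) e' (conj-shape k' s) v' , f'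
  where
  stop : ∀ {ρ γ L ps L' ps'} → Stop L → Tr ρ γ L ps L' ps' → Stop L'
  stop () (row _ _ _)
  stop st (down _ s' _ _ _ _ _ _) = s'
  stop st (jump _) = mark
  stop st end = []
tr-exists (mark f) k (jump {ρ = ρ} l v) with tr-exists f k v
... | L' , ps' , t , v' , f' = mark ∷ L' , jump ∷ ps' , jump t , jump (proj₁ (k _ _) l) v' , mark f'
tr-exists [] k (end z) = [] , [] , end , end (λ x → n≤0⇒n≡0 (≮⇒≥ λ l → n≮0 (subst (x <_) (z 0) (proj₂ (k 0 x) (≤-<-trans z≤n l))))) , []

at : Cells → ℕ → Cell
at []      i       = blank
at (x ∷ L) zero    = x
at (x ∷ L) (suc i) = at L i

-- Drop and Rise are how a descent at i shows in the cells i and i + 1 for the two reading orders.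
Drop Rise : Cell → Cell → Set
Drop blank   (row y) = ⊤
Drop mark    (row y) = ⊤
Drop (row x) (row y) = x < y
Drop _       _       = ⊥
Rise mark    (row y) = ⊤
Rise (row x) (row y) = y ≤ x
Rise _       _       = ⊥

tr-head : ∀ {ρ γ L ps L' ps'} → Tr ρ γ L ps L' ps' →
          (∃₂ λ q c → at L 0 ≡ row q × at L' 0 ≡ row c × c ≡ ρ q × q ≡ γ c)
          ⊎ (at L 0 ≡ mark × at L' 0 ≡ mark) ⊎ (at L 0 ≡ blank × at L' 0 ≡ blank)
tr-head (row e₁ e₂ t) = inj₁ (_ , _ , refl , refl , e₁ , e₂)
tr-head (jump t) = inj₂ (inj₁ (refl , refl))
tr-head end = inj₂ (inj₂ (refl , refl))
tr-head (down st st' _ _ _ _ _ t) with tr-head t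
... | inj₂ x = inj₂ x
... | inj₁ (_ , _ , e , _) = ⊥-elim (nr st e)
  where
  nr : ∀ {L q} → Stop L → at L 0 ≡ row q → ⊥
  nr [] ()
  nr mark ()

-- Of two boxes added in succession, the second lies in a lower row exactly when its column is not
-- to the right of the first. Marks compare with rows in the same way on both sides.
tr-drop : ∀ {ρ γ L ps L' ps'} → Conj ρ γ → Tr ρ γ L ps L' ps' → ∀ i →
          (Drop (at L i) (at L (suc i)) → Rise (at L' i) (at L' (suc i))) ×
          (Rise (at L' i) (at L' (suc i)) → Drop (at L i) (at L (suc i)))
tr-drop k (row e₁ e₂ t) (suc i) = tr-drop (conj-inc e₁ e₂ k) t i
tr-drop k (row {ρ} {γ} {q} {c} e₁ e₂ t) zero with tr-head t
... | inj₂ (inj₁ (h , h')) rewrite h | h' = (λ ()) , (λ ())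
... | inj₂ (inj₂ (h , h')) rewrite h | h' = (λ ()) , (λ ())
... | inj₁ (q' , c' , h , h' , e₃ , e₄) rewrite h | h' = to , from
  where
  k' = conj-inc e₁ e₂ k
  γc : inc c γ c ≡ suc q
  γc = trans (inc-≡ c γ) (cong suc (sym e₂))
  to : q < q' → c' ≤ c
  to l = ≮⇒≥ λ l' → <⇒≱ l (s≤s⁻¹ (subst (q' <_) γc (proj₁ (k' q' c) (subst (c <_) e₃ l'))))
  from : c' ≤ c → q < q'
  from l = ≰⇒> λ l' → <⇒≱ (subst (c <_) (sym e₃) (proj₂ (k' q' c) (subst (q' <_) (sym γc) (s≤s l')))) l
tr-drop k (down _ _ _ _ _ _ k' t) i = tr-drop k' t i
tr-drop k (jump t) (suc i) = tr-drop k t i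
tr-drop k (jump t) zero with tr-head t
... | inj₂ (inj₁ (h , h')) rewrite h | h' = (λ ()) , (λ ())
... | inj₂ (inj₂ (h , h')) rewrite h | h' = (λ ()) , (λ ())
... | inj₁ (q' , c' , h , h' , e₃ , e₄) rewrite h | h' = (λ _ → tt) , (λ _ → tt)
tr-drop k end i = (λ ()) , (λ ())

-- Decreasing subsequences and Schensted's theorem

-- Words are read from their last letter: the head of the list is the latest letter.
data Dec↓ : List ℕ → ℕ → ℕ → ℕ → Set where
  new : ∀ {s w} → Dec↓ (s ∷ w) 1 s s
  ext : ∀ {s w d x l} → Dec↓ w d x l → s < l → Dec↓ (s ∷ w) (suc d) x s
  old : ∀ {s w d x l} → Dec↓ w d x l → Dec↓ (s ∷ w) d x l

dec-≤ : ∀ {w d x l} → Dec↓ w d x l → l ≤ x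
dec-≤ new = ≤-refl
dec-≤ (ext c l) = ≤-trans (<⇒≤ l) (dec-≤ c)
dec-≤ (old c) = dec-≤ c

dec-top-∈ : ∀ {w d x l} → Dec↓ w d x l → x ∈ w
dec-top-∈ new = here refl
dec-top-∈ (ext c _) = there (dec-top-∈ c)
dec-top-∈ (old c) = there (dec-top-∈ c)

dec-single : ∀ {w z} → z ∈ w → Dec↓ w 1 z z
dec-single (here refl) = new
dec-single (there m) = old (dec-single m)

dec-0 : ∀ {w x l} → ¬ Dec↓ w 0 x l
dec-0 (old c) = dec-0 c

bump-row : ∀ {r₀ d c L L' z q} → Bump r₀ (down d) c L L' → at L z ≡ row q → ∃[ q' ] at L' z ≡ row q'
bump-row (base (stay _)) e = _ , e
bump-row {z = suc z} (skip b) e = bump-row {z = z} b e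
bump-row {z = zero} (hit b) e = _ , refl
bump-row {z = suc z} (hit b) e = bump-row {z = z} b e
bump-row {z = zero} (pass _ b) e = _ , refl
bump-row {z = suc z} (pass _ b) e = bump-row {z = z} b e

ins-row : ∀ {r₀ d s L L' z q} → Ins r₀ (down d) s L L' → at L z ≡ row q → ∃[ q' ] at L' z ≡ row q'
ins-row {z = suc z} (here b) e = bump-row {z = z} b e
ins-row {z = suc z} (blank i) e = ins-row {z = z} i e
ins-row {z = zero} (row i) e = _ , refl
ins-row {z = suc z} (row i) e = ins-row {z = z} i e

bump-row⁻ : ∀ {r₀ d c L L' z q} → Bump r₀ (down d) c L L' → at L' z ≡ row q → ∃[ q' ] at L z ≡ row q'
bump-row⁻ (base (stay _)) e = _ , e
bump-row⁻ {z = suc z} (skip b) e = bump-row⁻ {z = z} b e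
bump-row⁻ {z = zero} (hit b) e = _ , refl
bump-row⁻ {z = suc z} (hit b) e = bump-row⁻ {z = z} b e
bump-row⁻ {z = zero} (pass _ b) e = _ , refl
bump-row⁻ {z = suc z} (pass _ b) e = bump-row⁻ {z = z} b e

ins-row⁻ : ∀ {r₀ d s L L' z q} → Ins r₀ (down d) s L L' → at L' z ≡ row q → z ≡ s ⊎ (∃[ q' ] at L z ≡ row q')
ins-row⁻ {z = zero} (here b) e = inj₁ refl
ins-row⁻ {z = suc z} (here b) e = inj₂ (bump-row⁻ {z = z} b e)
ins-row⁻ {z = suc z} (blank i) e with ins-row⁻ {z = z} i e
... | inj₁ refl = inj₁ refl
... | inj₂ r = inj₂ r
ins-row⁻ {z = zero} (row i) e = inj₂ (_ , refl)
ins-row⁻ {z = suc z} (row i) e with ins-row⁻ {z = z} i e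
... | inj₁ refl = inj₁ refl
... | inj₂ r = inj₂ r

ins-at : ∀ {r₀ p s L L'} → Ins r₀ p s L L' → at L' s ≡ row 0
ins-at (here _) = refl
ins-at (blank i) = ins-at i
ins-at (row i) = ins-at i

ins-blank : ∀ {r₀ p s L L'} → Ins r₀ p s L L' → at L s ≡ blank
ins-blank (here _) = refl
ins-blank (blank i) = ins-blank i
ins-blank (row i) = ins-blank i

data Plain : Cells → Set where
  []    : Plain []
  blank : ∀ {L} → Plain L → Plain (blank ∷ L)
  row   : ∀ {q L} → Plain L → Plain (row q ∷ L)

bump-plain : ∀ {r₀ d c L L'} → Bump r₀ (down d) c L L' → Plain L → Plain L'
bump-plain (base (stay _)) p = p
bump-plain (skip b) (blank p) = blank (bump-plain b p)
bump-plain (hit b) (row p) = row (bump-plain b p)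
bump-plain (pass _ b) (row p) = row (bump-plain b p)

ins-plain : ∀ {r₀ d s L L'} → Ins r₀ (down d) s L L' → Plain L → Plain L'
ins-plain (here b) (blank p) = row (bump-plain b p)
ins-plain (blank i) (blank p) = blank (ins-plain i p)
ins-plain (row i) (row p) = row (ins-plain i p)

lower : Cell → Cell
lower blank         = blank
lower mark          = mark
lower (row zero)    = blank
lower (row (suc q)) = row q

lowers : Cells → Cells
lowers = map lower

lowers-at : ∀ L z {q} → at (lowers L) z ≡ row q → at L z ≡ row (suc q)
lowers-at (row (suc q) ∷ L) zero refl = refl
lowers-at (x ∷ L) (suc z) e = lowers-at L z e

lowers-at⁻ : ∀ L z {q} → at L z ≡ row (suc q) → at (lowers L) z ≡ row q
lowers-at⁻ (_ ∷ L) zero refl = refl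
lowers-at⁻ (x ∷ L) (suc z) e = lowers-at⁻ L z e

bump-lower : ∀ {r₀ d c L L'} → Bump r₀ (down d) (suc c) L L' → Plain L →
             ∃[ d' ] Bump r₀ (down d') c (lowers L) (lowers L')
bump-lower (base (stay [])) _ = _ , base (stay [])
bump-lower (skip b) (blank p) with bump-lower b p
... | d' , b' = d' , skip b'
bump-lower (hit b) (row p) with bump-lower b p
... | d' , b' = d' , hit b'
bump-lower (pass {q = zero} _ b) (row p) with bump-lower b p
... | d' , b' = d' , skip b'
bump-lower (pass {q = suc q} ne b) (row p) with bump-lower b p
... | d' , b' = d' , pass (ne ∘ cong suc) b'

bump-row0 : ∀ {r₀ d c L L' z} → Bump r₀ (down d) (suc c) L L' → at L z ≡ row 0 → at L' z ≡ row 0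
bump-row0 (base (stay _)) e = e
bump-row0 {z = suc z} (skip b) e = bump-row0 {z = z} b e
bump-row0 {z = suc z} (hit b) e = bump-row0 {z = z} b e
bump-row0 {z = zero} (pass _ b) e = e
bump-row0 {z = suc z} (pass _ b) e = bump-row0 {z = z} b e

bump-row0⁻ : ∀ {r₀ d c L L' z} → Bump r₀ (down d) c L L' → at L' z ≡ row 0 → at L z ≡ row 0
bump-row0⁻ (base (stay _)) e = e
bump-row0⁻ {z = suc z} (skip b) e = bump-row0⁻ {z = z} b e
bump-row0⁻ {z = suc z} (hit b) e = bump-row0⁻ {z = z} b e
bump-row0⁻ {z = zero} (pass _ b) e = e
bump-row0⁻ {z = suc z} (pass _ b) e = bump-row0⁻ {z = z} b e

ins-row0⁻ : ∀ {r₀ d s L L' z} → Ins r₀ (down d) s L L' → at L' z ≡ row 0 → z ≡ s ⊎ at L z ≡ row 0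
ins-row0⁻ {z = zero} (here b) e = inj₁ refl
ins-row0⁻ {z = suc z} (here b) e = inj₂ (bump-row0⁻ {z = z} b e)
ins-row0⁻ {z = suc z} (blank i) e with ins-row0⁻ {z = z} i e
... | inj₁ refl = inj₁ refl
... | inj₂ r = inj₂ r
ins-row0⁻ {z = zero} (row i) e = inj₂ e
ins-row0⁻ {z = suc z} (row i) e with ins-row0⁻ {z = z} i e
... | inj₁ refl = inj₁ refl
... | inj₂ r = inj₂ r

data Split₀ (r₀ : ℕ) (L L' : Cells) : Set where
  none  : lowers L' ≡ lowers L → (∀ z → at L z ≢ row 0) → Split₀ r₀ L L'
  first : ∀ b d → at L b ≡ row 0 → (∀ z → z < b → at L z ≢ row 0) →
          Ins r₀ (down d) b (lowers L) (lowers L') →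
          (∀ z → at L z ≡ row 0 → z ≡ b ⊎ at L' z ≡ row 0) → Split₀ r₀ L L'

bump-split : ∀ {r₀ d L L'} → Bump r₀ (down d) 0 L L' → Plain L → Split₀ r₀ L L'
bump-split (base (stay [])) _ = none refl (λ _ ())
bump-split (skip b) (blank p) with bump-split b p
... | none e f = none (cong (blank ∷_) e) λ { (suc z) → f z }
... | first x d e f i g = first (suc x) d e (λ { (suc z) l → f z (s≤s⁻¹ l) }) (blank i)
  λ { (suc z) h → Sum.map₁ (cong suc) (g z h) }
bump-split (hit b) (row p) with bump-lower b p
... | d' , b' = first 0 d' refl (λ _ ()) (here b') λ { zero _ → inj₁ refl ; (suc z) h → inj₂ (bump-row0 {z = z} b h) }
bump-split (pass {q = zero} ne b) (row p) = ⊥-elim (ne refl)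
bump-split (pass {q = suc q} ne b) (row p) with bump-split b p
... | none e f = none (cong (row q ∷_) e) λ { zero () ; (suc z) → f z }
... | first x d e f i g = first (suc x) d e (λ { zero _ () ; (suc z) l → f z (s≤s⁻¹ l) }) (row i)
  λ { (suc z) h → Sum.map₁ (cong suc) (g z h) }

-- One insertion seen as a change of the top row and, if a letter `b` is expelled from it, an
-- insertion of `b` into the remaining rows.
data Split (r₀ : ℕ) (s : ℕ) (L L' : Cells) : Set where
  none  : lowers L' ≡ lowers L → (∀ z → s < z → at L z ≢ row 0) →
          (∀ z → at L z ≡ row 0 → at L' z ≡ row 0) → Split r₀ s L L'
  first : ∀ b d → s < b → at L b ≡ row 0 → (∀ z → s < z → z < b → at L z ≢ row 0) →
          Ins r₀ (down d) b (lowers L) (lowers L') →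
          (∀ z → at L z ≡ row 0 → z ≡ b ⊎ at L' z ≡ row 0) → Split r₀ s L L'

ins-split : ∀ {r₀ d s L L'} → Ins r₀ (down d) s L L' → Plain L → Split r₀ s L L'
ins-split {L = blank ∷ L} {row 0 ∷ L'} (here b) (blank p) with bump-split b p
... | none e f = none (cong (blank ∷_) e) (λ { (suc z) _ → f z }) λ { (suc z) h → ⊥-elim (f z h) }
... | first x d e f i g = first (suc x) d z<s e (λ { (suc z) _ l → f z (s≤s⁻¹ l) }) (blank i)
  λ { (suc z) h → Sum.map₁ (cong suc) (g z h) }
ins-split (blank i) (blank p) with ins-split i p
... | none e f g = none (cong (blank ∷_) e) (λ { (suc z) l → f z (s≤s⁻¹ l) }) λ { (suc z) → g z }
... | first x d l e f i' g = first (suc x) d (s≤s l) e (λ { (suc z) l₁ l₂ → f z (s≤s⁻¹ l₁) (s≤s⁻¹ l₂) }) (blank i')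
  λ { (suc z) h → Sum.map₁ (cong suc) (g z h) }
ins-split {L = row zero ∷ _} (row i) (row p) with ins-split i p
... | none e f g = none (cong (blank ∷_) e) (λ { (suc z) l → f z (s≤s⁻¹ l) }) λ { zero h → h ; (suc z) → g z }
... | first x d l e f i' g = first (suc x) d (s≤s l) e (λ { (suc z) l₁ l₂ → f z (s≤s⁻¹ l₁) (s≤s⁻¹ l₂) }) (blank i')
  λ { zero h → inj₂ h ; (suc z) h → Sum.map₁ (cong suc) (g z h) }
ins-split {L = row (suc q) ∷ _} (row i) (row p) with ins-split i p
... | none e f g = none (cong (row q ∷_) e) (λ { (suc z) l → f z (s≤s⁻¹ l) }) λ { zero h → h ; (suc z) → g z }
... | first x d l e f i' g = first (suc x) d (s≤s l) e (λ { (suc z) l₁ l₂ → f z (s≤s⁻¹ l₁) (s≤s⁻¹ l₂) }) (row i')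
  λ { zero h → inj₂ h ; (suc z) h → Sum.map₁ (cong suc) (g z h) }

-- The ordinary Robinson-Schensted insertion tableau, without cuts.
data Full (r₀ n : ℕ) : List ℕ → Cells → Set where
  []  : Full r₀ n [] (replicate n blank)
  _∷_ : ∀ {s w d T T'} → Ins r₀ (down d) s T T' → Full r₀ n w T → Full r₀ n (s ∷ w) T'

plain-replicate : ∀ n → Plain (replicate n blank)
plain-replicate zero = []
plain-replicate (suc n) = blank (plain-replicate n)

lowers-replicate : ∀ n → lowers (replicate n blank) ≡ replicate n blank
lowers-replicate zero = refl
lowers-replicate (suc n) = cong (blank ∷_) (lowers-replicate n)

at-replicate : ∀ n z → at (replicate n blank) z ≡ blank
at-replicate zero z = refl
at-replicate (suc n) zero = refl
at-replicate (suc n) (suc z) = at-replicate n z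

full-plain : ∀ {r₀ n w T} → Full r₀ n w T → Plain T
full-plain {n = n} [] = plain-replicate n
full-plain (i ∷ f) = ins-plain i (full-plain f)

full-used : ∀ {r₀ n w T z} → Full r₀ n w T → z ∈ w → ∃[ q ] at T z ≡ row q
full-used (i ∷ f) (here refl) = 0 , ins-at i
full-used {z = z} (i ∷ f) (there m) with full-used f m
... | q , e = ins-row {z = z} i e

full-used⁻ : ∀ {r₀ n w T} z {q} → Full r₀ n w T → at T z ≡ row q → z ∈ w
full-used⁻ {n = n} z [] e with trans (sym e) (at-replicate n z)
... | ()
full-used⁻ z (i ∷ f) e with ins-row⁻ {z = z} i e
... | inj₁ refl = here refl
... | inj₂ (q , e') = there (full-used⁻ z f e')

Pre Post : List ℕ → ℕ → ℕ → ℕ → Set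
Pre  v d x l = d ≡ 0 ⊎ (∃₂ λ x' l' → x' ≤ x × l < l' × Dec↓ v d x' l')
Post v d x l = ∃[ x' ] x' ≤ x × Dec↓ v (suc d) x' l

pre-snoc : ∀ {v d x l b} → Pre v d x l → b ≤ l → l ≤ x → Post (b ∷ v) d x b
pre-snoc (inj₁ refl) b≤l l≤x = _ , ≤-trans b≤l l≤x , new
pre-snoc (inj₂ (x' , l' , x≤ , l< , c)) b≤l l≤x = x' , x≤ , ext c (≤-<-trans b≤l l<)

pre-old : ∀ {v d x l b} → Pre v d x l → Pre (b ∷ v) d x l
pre-old (inj₁ e) = inj₁ e
pre-old (inj₂ (x' , l' , a , b , c)) = inj₂ (x' , l' , a , b , old c)

-- Passing to the expelled letters costs a decreasing subsequence one letter and does not raise its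
-- top; going back gains one letter and keeps the top. The clauses about `row 0` strengthen the
-- induction: a letter still in the top row may be expelled later and then has to continue a
-- subsequence of `v`.
Down Up : List ℕ → Cells → List ℕ → Set
Down w T v = ∀ {d x l} → Dec↓ w (suc d) x l → Pre v d x l × (at T l ≡ row 0 ⊎ Post v d x l)
Up   w T v = ∀ {d x b} → Dec↓ v d x b →
  (∃[ l ] b ≤ l × Dec↓ w d x l) ×
  (∀ z → at T z ≡ row 0 → z < b → ∃[ l ] z ≤ l × Dec↓ w (suc d) x l) ×
  (∃[ l ] Dec↓ w (suc d) x l)

-- Viennot's shadow argument: v lists the letters expelled from the top row while w is inserted.
viennot : ∀ {r₀ n w T} → Full r₀ n w T → ∃[ v ] Full r₀ n v (lowers T) × Down w T v × Up w T v
viennot {n = n} [] = [] , subst (Full _ n []) (sym (lowers-replicate n)) [] , (λ ()) , (λ ())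
viennot {w = s ∷ w} {T'} (_∷_ {T = T} i f) with viennot f | ins-split i (full-plain f)
... | v , fv , dn , up | none e none> keep = v , subst (Full _ _ v) (sym e) fv , dn' , up'
  where
  dn' : Down (s ∷ w) T' v
  dn' new = inj₁ refl , inj₁ (ins-at i)
  dn' {suc d} {x} (ext {l = l} c s<l) with dn c
  ... | _ , inj₁ r = ⊥-elim (none> l s<l r)
  ... | _ , inj₂ (x' , x≤ , c') = inj₂ (x' , l , x≤ , s<l , c') , inj₁ (ins-at i)
  dn' {zero} (ext c _) = ⊥-elim (dec-0 c)
  dn' (old c) with dn c
  ... | p , inj₁ r = p , inj₁ (keep _ r)
  ... | p , inj₂ q = p , inj₂ q
  up' : Up (s ∷ w) T' v
  up' c with up c
  ... | (l , b≤l , c₁) , row< , (l₂ , c₂) = (l , b≤l , old c₁) , row<' , (l₂ , old c₂)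
    where
    row<' : ∀ z → at T' z ≡ row 0 → z < _ → _
    row<' z r z<b with ins-row0⁻ {z = z} i r
    ... | inj₁ refl = s , ≤-refl , ext c₁ (<-≤-trans z<b b≤l)
    ... | inj₂ r' with row< z r' z<b
    ...   | l' , z≤ , c' = l' , z≤ , old c'
... | v , fv , dn , up | first b d s<b rb gap ib keep = b ∷ v , ib ∷ fv , dn' , up'
  where
  dn' : Down (s ∷ w) T' (b ∷ v)
  dn' new = inj₁ refl , inj₁ (ins-at i)
  dn' {zero} (ext c _) = ⊥-elim (dec-0 c)
  dn' {suc d} {x} (ext {l = l} c s<l) with dn c
  ... | _ , inj₂ (x' , x≤ , c') = inj₂ (x' , l , x≤ , s<l , old c') , inj₁ (ins-at i)
  -- Here `l` is a top entry above `s`, hence not below `b`, the least of these; so the newly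
  -- expelled `b` continues the subsequence of `v`.
  ... | pre , inj₁ r with pre-snoc pre (≮⇒≥ λ l<b → gap l s<l l<b r) (dec-≤ c)
  ...   | x' , x≤ , c' = inj₂ (x' , b , x≤ , s<b , c') , inj₁ (ins-at i)
  dn' (old c) with dn c
  ... | p , inj₂ (x' , x≤ , c') = pre-old p , inj₂ (x' , x≤ , old c')
  ... | p , inj₁ r with keep _ r
  ...   | inj₂ r' = pre-old p , inj₁ r'
  ...   | inj₁ refl = pre-old p , inj₂ (pre-snoc p ≤-refl (dec-≤ c))
  near : ∀ z → at T' z ≡ row 0 → z < b → z ≤ s
  near z r z<b with ins-row0⁻ {z = z} i r
  ... | inj₁ refl = ≤-refl
  ... | inj₂ r' = ≮⇒≥ λ s<z → gap z s<z z<b r'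
  up' : Up (s ∷ w) T' (b ∷ v)
  up' new = (b , ≤-refl , old bc) , (λ z r z<b → s , near z r z<b , ext bc s<b) , (s , ext bc s<b)
    where bc = dec-single (full-used⁻ b f rb)
  up' (ext c b<) with up c
  -- The clause on top entries is needed here: `b` was one until now and lies below the end of the
  -- subsequence.
  ... | _ , row< , _ with row< b rb b<
  ...   | l , b≤l , c₁ = (l , b≤l , old c₁) , (λ z r z<b → s , near z r z<b , c₂) , (s , c₂)
    where c₂ = ext c₁ (<-≤-trans s<b b≤l)
  up' (old c) with up c
  ... | (l , b≤l , c₁) , row< , (l₂ , c₂) = (l , b≤l , old c₁) , row<' , (l₂ , old c₂)
    where
    row<' : ∀ z → at T' z ≡ row 0 → z < _ → _
    row<' z r z<b with ins-row0⁻ {z = z} i r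
    ... | inj₁ refl = s , ≤-refl , ext c₁ (<-≤-trans z<b b≤l)
    ... | inj₂ r' with row< z r' z<b
    ...   | l' , z≤ , c' = l' , z≤ , old c'

full-dec : ∀ {r₀ n w T} z {q} → Full r₀ n w T → at T z ≡ row q → ∃[ l ] Dec↓ w (suc q) z l
full-dec z {zero} f e = z , dec-single (full-used⁻ z f e)
full-dec {T = T} z {suc q} f e with viennot f
... | v , fv , _ , up with full-dec z fv (lowers-at⁻ T z e)
...   | l , c = proj₂ (proj₂ (up c))

-- Each removal of a top row shortens the subsequence by one and cannot raise its top, so the entry
-- found at the end is at most `x`.
dec-full : ∀ {r₀ n w T q x l} → Full r₀ n w T → Dec↓ w (suc q) x l →
           ∃₂ λ z q' → z ≤ x × at T z ≡ row q' × q ≤ q'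
dec-full {q = zero} {x} f c with full-used f (dec-top-∈ c)
... | q' , e = x , q' , ≤-refl , e , z≤n
dec-full {T = T} {suc q} f c with viennot f
... | v , fv , dn , _ with proj₁ (dn c)
...   | inj₂ (x' , l' , x≤ , _ , c') with dec-full fv c'
...     | z , q' , z≤ , e , q≤ = z , suc q' , ≤-trans z≤ x≤ , lowers-at T z e , s≤s q≤

-- What an insertion preserves

bump-length : ∀ {r₀ p c L L'} → Bump r₀ p c L L' → length L' ≡ length L
bump-length (base (stay _)) = refl
bump-length (base (cut _)) = refl
bump-length (skip b) = cong suc (bump-length b)
bump-length (hit b) = cong suc (bump-length b)
bump-length (pass _ b) = cong suc (bump-length b)

ins-length : ∀ {r₀ p s L L'} → Ins r₀ p s L L' → length L' ≡ length L
ins-length (here b) = cong suc (bump-length b)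
ins-length (blank i) = cong suc (ins-length i)
ins-length (row i) = cong suc (ins-length i)

ins-< : ∀ {r₀ p s L L'} → Ins r₀ p s L L' → s < length L
ins-< (here b) = z<s
ins-< (blank i) = s≤s (ins-< i)
ins-< (row i) = s≤s (ins-< i)

bump-blank : ∀ {r₀ p c L L'} z → Bump r₀ p c L L' → at L z ≡ blank → at L' z ≡ blank
bump-blank z (base (stay _)) e = e
bump-blank (suc z) (base (cut _)) e = e
bump-blank zero (skip b) e = e
bump-blank (suc z) (skip b) e = bump-blank z b e
bump-blank (suc z) (hit b) e = bump-blank z b e
bump-blank (suc z) (pass _ b) e = bump-blank z b e

bump-blank⁻ : ∀ {r₀ p c L L'} z → Bump r₀ p c L L' → at L' z ≡ blank → at L z ≡ blank
bump-blank⁻ z (base (stay _)) e = e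
bump-blank⁻ (suc z) (base (cut _)) e = e
bump-blank⁻ zero (skip b) e = e
bump-blank⁻ (suc z) (skip b) e = bump-blank⁻ z b e
bump-blank⁻ (suc z) (hit b) e = bump-blank⁻ z b e
bump-blank⁻ (suc z) (pass _ b) e = bump-blank⁻ z b e

ins-blank→ : ∀ {r₀ p s L L'} z → Ins r₀ p s L L' → z ≢ s → at L z ≡ blank → at L' z ≡ blank
ins-blank→ zero (here b) ne e = ⊥-elim (ne refl)
ins-blank→ (suc z) (here b) ne e = bump-blank z b e
ins-blank→ zero (blank i) ne e = e
ins-blank→ (suc z) (blank i) ne e = ins-blank→ z i (ne ∘ cong suc) e
ins-blank→ (suc z) (row i) ne e = ins-blank→ z i (ne ∘ cong suc) e

ins-blank← : ∀ {r₀ p s L L'} z → Ins r₀ p s L L' → at L' z ≡ blank → z ≢ s × at L z ≡ blank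
ins-blank← (suc z) (here b) e = (λ ()) , bump-blank⁻ z b e
ins-blank← zero (blank i) e = (λ ()) , e
ins-blank← (suc z) (blank i) e with ins-blank← z i e
... | ne , e' = ne ∘ suc-injective , e'
ins-blank← (suc z) (row i) e with ins-blank← z i e
... | ne , e' = ne ∘ suc-injective , e'

filled-at : ∀ {L} y → Filled L → y < length L → at L y ≢ blank
filled-at zero (row f) l ()
filled-at (suc y) (row f) l = filled-at y f (s≤s⁻¹ l)
filled-at zero (mark f) l ()
filled-at (suc y) (mark f) l = filled-at y f (s≤s⁻¹ l)

at-filled : ∀ L → (∀ y → y < length L → at L y ≢ blank) → Filled L
at-filled [] h = []
at-filled (blank ∷ L) h = ⊥-elim (h 0 z<s refl)
at-filled (mark ∷ L) h = mark (at-filled L λ y l → h (suc y) (s≤s l))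
at-filled (row q ∷ L) h = row (at-filled L λ y l → h (suc y) (s≤s l))

filled-tidy : ∀ {L} → Filled L → Tidy L
filled-tidy [] = []
filled-tidy (row f) = row (filled-tidy f)
filled-tidy (mark f) = mark f

bump-tidy : ∀ {r₀ p c L L'} → Bump r₀ p c L L' → Tidy L → Tidy L'
bump-tidy (base (stay _)) t = t
bump-tidy (base (cut f)) t = mark f
bump-tidy (skip b) (blank t) = blank (bump-tidy b t)
bump-tidy (hit b) (row t) = row (bump-tidy b t)
bump-tidy (pass _ b) (row t) = row (bump-tidy b t)

ins-tidy : ∀ {r₀ p s L L'} → Ins r₀ p s L L' → Tidy L → Tidy L'
ins-tidy (here b) (blank t) = row (bump-tidy b t)
ins-tidy (blank i) (blank t) = blank (ins-tidy i t)
ins-tidy (row i) (row t) = row (ins-tidy i t)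

bump-tidy⁻ : ∀ {r₀ p c L L'} → Bump r₀ p c L L' → Tidy L' → Tidy L
bump-tidy⁻ (base (stay _)) t = t
bump-tidy⁻ (base (cut f)) t = row (filled-tidy f)
bump-tidy⁻ (skip b) (blank t) = blank (bump-tidy⁻ b t)
bump-tidy⁻ (hit b) (row t) = row (bump-tidy⁻ b t)
bump-tidy⁻ (pass _ b) (row t) = row (bump-tidy⁻ b t)

ins-tidy⁻ : ∀ {r₀ p s L L'} → Ins r₀ p s L L' → Tidy L' → Tidy L
ins-tidy⁻ (here b) (row t) = blank (bump-tidy⁻ b t)
ins-tidy⁻ (blank i) (blank t) = blank (ins-tidy⁻ i t)
ins-tidy⁻ (row i) (row t) = row (ins-tidy⁻ i t)

tidy-free : ∀ {L} s → Tidy L → s < length L → at L s ≡ blank → Free s L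
tidy-free zero (blank t) l e = here
tidy-free (suc s) (blank t) l e = blank (tidy-free s t (s≤s⁻¹ l) e)
tidy-free (suc s) (row t) l e = row (tidy-free s t (s≤s⁻¹ l) e)
tidy-free (suc s) (mark f) l e = ⊥-elim (filled-at s f (s≤s⁻¹ l) e)

tidy-replicate : ∀ n → Tidy (replicate n blank)
tidy-replicate zero = []
tidy-replicate (suc n) = blank (tidy-replicate n)

Rows : ℕ → Cells → Set
Rows r₀ L = ∀ z {q} → at L z ≡ row q → q ≤ r₀

bump-rows : ∀ {r₀ p c L L'} → Short r₀ p → Bump r₀ p c L L' → Rows r₀ L → Rows r₀ L'
bump-rows sh (base (stay _)) h = h
bump-rows sh (base (cut _)) h (suc z) e = h (suc z) e
bump-rows sh (skip b) h (suc z) e = bump-rows sh b (h ∘ suc) z e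
bump-rows sh (hit b) h zero refl = ≤-trans (bump-lim b) (short-lim sh)
bump-rows sh (hit b) h (suc z) e = bump-rows sh b (h ∘ suc) z e
bump-rows sh (pass _ b) h zero refl = h zero refl
bump-rows sh (pass _ b) h (suc z) e = bump-rows sh b (h ∘ suc) z e

ins-rows : ∀ {r₀ p s L L'} → Short r₀ p → Ins r₀ p s L L' → Rows r₀ L → Rows r₀ L'
ins-rows sh (here b) h zero refl = z≤n
ins-rows sh (here b) h (suc z) e = bump-rows sh b (h ∘ suc) z e
ins-rows sh (blank i) h (suc z) e = ins-rows sh i (h ∘ suc) z e
ins-rows sh (row i) h zero refl = h zero refl
ins-rows sh (row i) h (suc z) e = ins-rows sh i (h ∘ suc) z e

-- Truncated and untruncated tableaux

-- T carries the untruncated insertion tableau: it agrees with L up to the first mark, where it has row r₀ + 1.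
data Agree (r₀ : ℕ) : Cells → Cells → Set where
  []    : Agree r₀ [] []
  blank : ∀ {T L} → Agree r₀ T L → Agree r₀ (blank ∷ T) (blank ∷ L)
  row   : ∀ {q T L} → Agree r₀ T L → Agree r₀ (row q ∷ T) (row q ∷ L)
  mark  : ∀ {T L} → Agree r₀ (row (suc r₀) ∷ T) (mark ∷ L)

agree-replicate : ∀ {r₀} n → Agree r₀ (replicate n blank) (replicate n blank)
agree-replicate zero = []
agree-replicate (suc n) = blank (agree-replicate n)

-- In T a cut is an ordinary hit that sends a letter to row r₀ + 1. Later scans of L reach the mark
-- with a carry of at most r₀, so in T they pass that letter, which stays where it is.
bump-agree : ∀ {r₀ p c L L' T} → Short r₀ p → Agree r₀ T L → Bump r₀ p c L L' →
             ∃₂ λ d T' → Bump r₀ (down d) c T T' × Agree r₀ T' L'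
bump-agree sh [] (base (stay [])) = _ , [] , base (stay []) , []
bump-agree {r₀} sh (mark {T}) (base (stay {d} mark)) with bump-total r₀ d T
... | d' , T' , b = d' , _ , pass (λ { refl → <-irrefl refl (short-lim sh) }) b , mark
bump-agree {r₀} sh (row {T = T} a) (base (cut f)) with bump-total r₀ (suc r₀) T
... | d' , T' , b = d' , _ , hit b , mark
bump-agree sh (blank a) (base (stay ()))
bump-agree sh (row a) (base (stay ()))
bump-agree sh (blank a) (skip b) with bump-agree sh a b
... | d , T' , b' , a' = d , _ , skip b' , blank a'
bump-agree sh (row a) (hit b) with bump-agree sh a b
... | d , T' , b' , a' = d , _ , hit b' , row a'
bump-agree sh (row a) (pass ne b) with bump-agree sh a b
... | d , T' , b' , a' = d , _ , pass ne b' , row a'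

ins-agree : ∀ {r₀ p s L L' T} → Short r₀ p → Agree r₀ T L → Ins r₀ p s L L' →
            ∃₂ λ d T' → Ins r₀ (down d) s T T' × Agree r₀ T' L'
ins-agree sh (blank a) (here b) with bump-agree sh a b
... | d , T' , b' , a' = d , _ , here b' , row a'
ins-agree sh (blank a) (blank i) with ins-agree sh a i
... | d , T' , b' , a' = d , _ , blank b' , blank a'
ins-agree sh (row a) (row i) with ins-agree sh a i
... | d , T' , b' , a' = d , _ , row b' , row a'

-- Before the first mark T has the rows of L, none beyond r₀; so such an entry lies at the mark or
-- behind it, where nothing is blank.
agree-after : ∀ {r₀ T L} z y {q} → Agree r₀ T L → Tidy L → Rows r₀ L →
              at T z ≡ row q → r₀ < q → z < y → y < length L → at L y ≢ blank
agree-after (suc z) (suc y) (blank a) (blank t) h e l l₁ l₂ =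
  agree-after z y a t (h ∘ suc) e l (s≤s⁻¹ l₁) (s≤s⁻¹ l₂)
agree-after zero y (row a) (row t) h refl l l₁ l₂ = ⊥-elim (<⇒≱ l (h zero refl))
agree-after (suc z) (suc y) (row a) (row t) h e l l₁ l₂ =
  agree-after z y a t (h ∘ suc) e l (s≤s⁻¹ l₁) (s≤s⁻¹ l₂)
agree-after z (suc y) mark (mark f) h e l l₁ l₂ = filled-at y f (s≤s⁻¹ l₂)

-- An entry that reaches row r₀ + 1 does so before the first mark, where T undergoes the same moves.
-- This carries the overflow to T, to which Schensted's theorem applies.
bump-overflow : ∀ {r₀ d c L L' T} → Agree r₀ T L → Rows r₀ L → Bump r₀ (down d) c L L' →
  ∃₂ λ d' T' → Bump r₀ (down d') c T T' × (∀ e → at L' e ≡ row (suc r₀) → at T' e ≡ row (suc r₀))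
bump-overflow {r₀} {c = c} {T = T} a h (base (stay _)) with bump-total r₀ c T
... | d' , T' , b = d' , T' , b , λ e eq → ⊥-elim (<-irrefl refl (h e eq))
bump-overflow (blank a) h (skip b) with bump-overflow a (h ∘ suc) b
... | d' , T' , b' , g = d' , _ , skip b' , λ { (suc e) → g e }
bump-overflow (row a) h (hit b) with bump-overflow a (h ∘ suc) b
... | d' , T' , b' , g = d' , _ , hit b' , λ { zero eq → eq ; (suc e) → g e }
bump-overflow (row a) h (pass ne b) with bump-overflow a (h ∘ suc) b
... | d' , T' , b' , g = d' , _ , pass ne b' , λ { zero eq → eq ; (suc e) → g e }

ins-overflow : ∀ {r₀ d s L L' T} → Agree r₀ T L → Rows r₀ L → Ins r₀ (down d) s L L' →
  ∃₂ λ d' T' → Ins r₀ (down d') s T T' × (∀ e → at L' e ≡ row (suc r₀) → at T' e ≡ row (suc r₀))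
ins-overflow (blank a) h (here b) with bump-overflow a (h ∘ suc) b
... | d' , T' , b' , g = d' , _ , here b' , λ { (suc e) → g e }
ins-overflow (blank a) h (blank i) with ins-overflow a (h ∘ suc) i
... | d' , T' , b' , g = d' , _ , blank b' , λ { (suc e) → g e }
ins-overflow (row a) h (row i) with ins-overflow a (h ∘ suc) i
... | d' , T' , b' , g = d' , _ , row b' , λ { zero eq → eq ; (suc e) → g e }

After : ℕ → Cells → Set
After r₀ L = ∀ e y → at L e ≡ row (suc r₀) → e < y → y < length L → at L y ≢ blank

after-tail : ∀ {r₀ x L} → After r₀ (x ∷ L) → After r₀ L
after-tail h e y eq l₁ l₂ = h (suc e) (suc y) eq (s≤s l₁) (s≤s l₂)

-- A scan that ends beyond row r₀ has hit an entry of row r₀ on its way; the cut can be made at that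
-- entry.
bump-cut : ∀ {r₀ d c L L'} → c ≤ r₀ → r₀ < d → After r₀ L' → Bump r₀ (down d) c L L' → ∃[ L₁ ] Bump r₀ jump c L L₁
bump-cut c≤ l h (base (stay _)) = ⊥-elim (<⇒≱ l c≤)
bump-cut c≤ l h (skip b) with bump-cut c≤ l (after-tail h) b
... | L₁ , b' = _ , skip b'
bump-cut c≤ l h (pass ne b) with bump-cut c≤ l (after-tail h) b
... | L₁ , b' = _ , pass ne b'
bump-cut {r₀} {c = c} c≤ l h (hit b) with c ≟ r₀
... | yes refl = _ , base (cut (at-filled _ λ y y< e →
        h zero (suc y) refl z<s (s≤s (subst (y <_) (sym (bump-length b)) y<)) (bump-blank y b e)))
... | no ne with bump-cut (≤∧≢⇒< c≤ ne) l (after-tail h) b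
...   | L₁ , b' = _ , hit b'

ins-cut : ∀ {r₀ d s L L'} → r₀ < d → After r₀ L' → Ins r₀ (down d) s L L' → ∃[ L₁ ] Ins r₀ jump s L L₁
ins-cut l h (here b) with bump-cut z≤n l (after-tail h) b
... | L₁ , b' = _ , here b'
ins-cut l h (blank i) with ins-cut l (after-tail h) i
... | L₁ , i' = _ , blank i'
ins-cut l h (row i) with ins-cut l (after-tail h) i
... | L₁ , i' = _ , row i'

-- Words for 23...k1 and their walks

V-[] : ∀ {i b j m ρ L} → V i b j m ρ L [] → (∀ x → ρ x ≡ 0) × L ≡ replicate (length L) blank
V-[] (blank v) with V-[] v
... | z , e = z , cong (blank ∷_) e
V-[] (row {q} {ρ} s v) with trans (sym (inc-≡ q ρ)) (proj₁ (V-[] v) q)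
... | ()
V-[] (end z) = z , refl

V-replicate : ∀ {i b j m} n → V i b j m (λ _ → 0) (replicate n blank) []
V-replicate zero = end (λ _ → refl)
V-replicate (suc n) = blank (V-replicate n)

-- Part i and all later parts vanish along the walk, so no box can be removed there.
V-down : ∀ {i b j m ρ L d ps} → b ≡ 0 → Shape i b ρ → V i b j m ρ L (down d ∷ ps) → d < i
V-down e s (blank v) = V-down e s v
V-down e s (row s' v) = V-down e s' v
V-down {i} {ρ = ρ} {d = d} refl s (down {ρ' = ρ'} _ e _ _) = ≰⇒> λ i≤d →
  <⇒≱ (subst (0 <_) (sym (trans (e d) (inc-≡ d ρ'))) z<s) (≤-trans (desc-mono (desc s) i≤d) (bound s))

shape-∅ : ∀ {i b} → Shape i b (λ _ → 0)
shape-∅ = (λ _ → z≤n) , z≤n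

-- The insertion process for 23…k1, with k = r₀ + 3.
module G (r₀ n : ℕ) where

  -- Row r₀ + 1 is always empty and row r₀ is nonempty at marks: at most r rows, and exactly r at a
  -- cut.
  Valid : Cells → List Step → Set
  Valid = V (suc r₀) 0 r₀ 0 (λ _ → 0)

  data Run : List ℕ → Cells → List Step → Set where
    []   : Run [] (replicate n blank) []
    step : ∀ {w L L' ps p s} → Run w L ps → s < n → s ∉ w → Short r₀ p → Ins r₀ p s L L' → Run (s ∷ w) L' (p ∷ ps)

  valid : ∀ {w L ps} → Run w L ps → Valid L ps
  valid [] = V-replicate n
  valid (step r _ _ sh i) = ins-fwd (inj₂ (s≤s (short-lim sh))) (λ σ _ → subst (0 <_) (sym (inc-≡ r₀ σ)) z<s)
    (λ ()) shape-∅ (valid r) i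

  run-length : ∀ {w L ps} → Run w L ps → length L ≡ n
  run-length [] = length-replicate n
  run-length (step r _ _ _ i) = trans (ins-length i) (run-length r)

  tidy : ∀ {w L ps} → Run w L ps → Tidy L
  tidy [] = tidy-replicate n
  tidy (step r _ _ _ i) = ins-tidy i (tidy r)

  rows : ∀ {w L ps} → Run w L ps → Rows r₀ L
  rows [] z e with trans (sym e) (at-replicate n z)
  ... | ()
  rows (step r _ _ sh i) = ins-rows sh i (rows r)

  unused : ∀ {w L ps} z → Run w L ps → z ∉ w → at L z ≡ blank
  unused z [] m = at-replicate n z
  unused z (step r _ _ _ i) m = ins-blank→ z i (m ∘ here) (unused z r (m ∘ there))

  unused⁻ : ∀ {w L ps} z → Run w L ps → at L z ≡ blank → z ∉ w
  unused⁻ z (step r _ _ _ i) e (here refl) = proj₁ (ins-blank← z i e) refl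
  unused⁻ z (step r _ _ _ i) e (there m) = unused⁻ z r (proj₂ (ins-blank← z i e)) m

  full : ∀ {w L ps} → Run w L ps → ∃[ T ] Full r₀ n w T × Agree r₀ T L
  full [] = _ , [] , agree-replicate n
  full (step r _ _ sh i) with full r
  ... | T , f , a with ins-agree sh a i
  ...   | d , T' , i' , a' = T' , i' ∷ f , a'

  data Good : List ℕ → Set where
    []   : Good []
    step : ∀ {s w} → Good w → s < n → s ∉ w →
           (∀ {y x l} → y < n → y ∉ s ∷ w → Dec↓ (s ∷ w) (suc (suc r₀)) x l → y ≤ x) → Good (s ∷ w)

  good : ∀ {w L ps} → Run w L ps → Good w
  good [] = []
  good R@(step r s< s∉ sh i) = step (good r) s< s∉ λ {y} y< y∉ c → ≮⇒≥ λ x<y → bad {y} y< y∉ c x<y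
    where
    bad : ∀ {y x l} → y < n → y ∉ _ → Dec↓ _ (suc (suc r₀)) x l → x < y → ⊥
    bad {y} y< y∉ c x<y with full R
    ... | T , f , a with dec-full f c
    ...   | z , q , z≤x , e , l =
      agree-after z y a (tidy R) (rows R) e l (≤-<-trans z≤x x<y) (subst (y <_) (sym (run-length R)) y<) (unused y R y∉)

  encode : ∀ {w} → Good w → ∃₂ λ L ps → Run w L ps
  encode [] = _ , _ , []
  encode (step {s} {w} g s< s∉ ok) with encode g
  ... | L , ps , r with ins-total r₀ (tidy-free s (tidy r) (subst (s <_) (sym (run-length r)) s<) (unused s r s∉))
  ...   | d , L' , i with d ≤? r₀
  ...     | yes l = L' , _ , step r s< s∉ (inj₂ (d , refl , l)) i
  ...     | no ¬l with full r
  ...       | T , f , a with ins-overflow a (rows r) i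
  ...         | d' , T' , i' , over with ins-cut (≰⇒> ¬l) aft i
    where
    aft : After r₀ L'
    aft e y eq e<y y< yb with full-dec e (i' ∷ f) (over e eq) | ins-blank← y i yb
    ... | l , c | y≢s , yb' = <⇒≱ e<y (ok (subst (y <_) (trans (ins-length i) (run-length r)) y<)
            (λ { (here refl) → y≢s refl ; (there m) → unused⁻ y r yb' m }) c)
  ...           | L₁ , i₁ = L₁ , _ , step r s< s∉ (inj₁ refl) i₁

  decode : ∀ {L} ps → length L ≡ n → Tidy L → Valid L ps → ∃[ w ] Run w L ps
  decode [] e t v with V-[] v
  ... | _ , eq = [] , subst (λ L → Run [] L []) (sym (trans eq (cong (λ k → replicate k blank) e))) []
  decode (p ∷ ps) e t v with ins-back uncut t v
    where
    -- At a mark row r₀ is the last nonempty row, hence it ends in a removable corner.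
    uncut : ∀ {σ} → p ≡ jump → Shape (suc r₀) 0 σ → 0 < σ r₀ → ∃[ ρ ] σ ≗ inc r₀ ρ × Shape (suc r₀) 0 ρ
    uncut {σ} _ s l = dec r₀ σ , inc-dec r₀ σ l , (desc-dec (desc s) (≤-<-trans (bound s) l) ,
      ≤-trans (subst (dec r₀ σ (suc r₀) ≤_) (sym (inc-dec r₀ σ l (suc r₀))) (inc-≥ r₀ (dec r₀ σ) (suc r₀))) (bound s))
  ... | s , L₀ , i , v₀ with decode ps (trans (sym (ins-length i)) e) (ins-tidy⁻ i t) v₀
  ...   | w , r = s ∷ w , step r (subst (s <_) (run-length r) (ins-< i)) (unused⁻ s r (ins-blank i)) (short p v) i
    where
    short : ∀ {L} p → Valid L (p ∷ ps) → Short r₀ p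
    short jump _ = inj₁ refl
    short (down d) v = inj₂ (d , refl , s≤s⁻¹ (V-down refl shape-∅ v))

  det : ∀ {w L L₁ ps ps₁} → Run w L ps → Run w L₁ ps₁ → L ≡ L₁ × ps ≡ ps₁
  det [] [] = refl , refl
  det (step r _ _ sh i) (step r₁ _ _ sh₁ i₁) with det r r₁
  ... | refl , refl with ins-det sh sh₁ i i₁
  ...   | refl , refl = refl , refl

  inj : ∀ {w w₁ L ps} → Run w L ps → Run w₁ L ps → w ≡ w₁
  inj [] [] = refl
  inj (step r _ _ _ i) (step r₁ _ _ _ i₁) with ins-inj i i₁
  ... | refl , refl = cong (_ ∷_) (inj r r₁)

-- Increasing subsequences, the top row, and capping

data Inc↑ : List ℕ → ℕ → ℕ → Set where
  new : ∀ {s w} → Inc↑ (s ∷ w) 1 s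
  ext : ∀ {s w d l} → Inc↑ w d l → l < s → Inc↑ (s ∷ w) (suc d) s
  old : ∀ {s w d l} → Inc↑ w d l → Inc↑ (s ∷ w) d l

N-0 : ∀ L → N L 0 ≡ 0
N-0 [] = refl
N-0 (blank ∷ L) = refl
N-0 (mark ∷ L) = refl
N-0 (row x ∷ L) = refl

N-mono : ∀ L {y z} → y ≤ z → N L y ≤ N L z
N-mono [] l = z≤n
N-mono (mark ∷ L) l = z≤n
N-mono (blank ∷ L) z≤n = z≤n
N-mono (blank ∷ L) (s≤s l) = N-mono L l
N-mono (row q ∷ L) z≤n = z≤n
N-mono (row zero ∷ L) (s≤s l) = s≤s (N-mono L l)
N-mono (row (suc q) ∷ L) (s≤s l) = N-mono L l

N-jump : ∀ L y → N L y < N L (suc y) → at L y ≡ row 0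
N-jump (blank ∷ L) zero l rewrite N-0 L = ⊥-elim (n≮0 l)
N-jump (blank ∷ L) (suc y) l = N-jump L y l
N-jump (row zero ∷ L) zero l = refl
N-jump (row (suc q) ∷ L) zero l rewrite N-0 L = ⊥-elim (n≮0 l)
N-jump (row zero ∷ L) (suc y) l = N-jump L y (s≤s⁻¹ l)
N-jump (row (suc q) ∷ L) (suc y) l = N-jump L y l

bump-N+ : ∀ {r₀ d c L L'} → Bump r₀ (down d) (suc c) L L' → ∀ y → N L' y ≡ N L y
bump-N+ (base (stay _)) y = refl
bump-N+ (skip b) zero = refl
bump-N+ (skip b) (suc y) = bump-N+ b y
bump-N+ (hit b) zero = refl
bump-N+ (hit b) (suc y) = bump-N+ b y
bump-N+ (pass _ b) zero = refl
bump-N+ (pass {q = zero} _ b) (suc y) = cong suc (bump-N+ b y)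
bump-N+ (pass {q = suc q} _ b) (suc y) = bump-N+ b y

bump-N : ∀ {r₀ d L L'} → Bump r₀ (down d) 0 L L' → ∀ y → (N L' y ≡ N L y × N L y ≡ 0) ⊎ suc (N L' y) ≡ N L y
bump-N (base (stay [])) y = inj₁ (refl , refl)
bump-N (base (stay mark)) y = inj₁ (refl , refl)
bump-N (skip b) zero = inj₁ (refl , refl)
bump-N (skip b) (suc y) = bump-N b y
bump-N (hit b) zero = inj₁ (refl , refl)
bump-N (hit b) (suc y) = inj₂ (cong suc (bump-N+ b y))
bump-N (pass _ b) zero = inj₁ (refl , refl)
bump-N (pass {q = zero} ne b) (suc y) = ⊥-elim (ne refl)
bump-N (pass {q = suc q} _ b) (suc y) = bump-N b y

ins-N≤ : ∀ {r₀ d s L L'} → Ins r₀ (down d) s L L' → ∀ y → y ≤ s → N L' y ≡ N L y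
ins-N≤ (here b) zero l = refl
ins-N≤ (blank i) zero l = refl
ins-N≤ (blank i) (suc y) l = ins-N≤ i y (s≤s⁻¹ l)
ins-N≤ (row i) zero l = refl
ins-N≤ (row {zero} i) (suc y) l = cong suc (ins-N≤ i y (s≤s⁻¹ l))
ins-N≤ (row {suc q} i) (suc y) l = ins-N≤ i y (s≤s⁻¹ l)

-- If the count grows, there was no top entry between s and y: the first such entry would have been
-- expelled in exchange for s.
ins-N> : ∀ {r₀ d s L L'} → Ins r₀ (down d) s L L' → ∀ y → s < y →
         N L' y ≡ N L y ⊎ (N L' y ≡ suc (N L y) × N L y ≡ N L s)
ins-N> (here b) (suc y) l with bump-N b y
... | inj₁ (e , z) = inj₂ (cong suc e , z)
... | inj₂ e = inj₁ e
ins-N> (blank i) (suc y) l = ins-N> i y (s≤s⁻¹ l)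
ins-N> (row {zero} i) (suc y) l with ins-N> i y (s≤s⁻¹ l)
... | inj₁ e = inj₁ (cong suc e)
... | inj₂ (e , e') = inj₂ (cong suc e , cong suc e')
ins-N> (row {suc q} i) (suc y) l = ins-N> i y (s≤s⁻¹ l)

ins-N-mono : ∀ {r₀ d s L L'} → Ins r₀ (down d) s L L' → ∀ y → N L y ≤ N L' y
ins-N-mono {s = s} i y with y ≤? s
... | yes l = ≤-reflexive (sym (ins-N≤ i y l))
... | no ¬l with ins-N> i y (≰⇒> ¬l)
...   | inj₁ e = ≤-reflexive (sym e)
...   | inj₂ (e , _) = ≤-trans (n≤1+n _) (≤-reflexive (sym e))

ins-N-suc : ∀ {r₀ d s L L'} → Ins r₀ (down d) s L L' → suc (N L s) ≤ N L' (suc s)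
ins-N-suc (here b) = s≤s z≤n
ins-N-suc (blank i) = ins-N-suc i
ins-N-suc (row {zero} i) = s≤s (ins-N-suc i)
ins-N-suc (row {suc q} i) = ins-N-suc i

data Cap : ℕ → Cells → Cells → Set where
  here  : ∀ {h} → Filled h → Cap 0 (blank ∷ h) (mark ∷ h)
  blank : ∀ {e L L'} → Cap e L L' → Cap (suc e) (blank ∷ L) (blank ∷ L')
  row   : ∀ {q e L L'} → Cap e L L' → Cap (suc e) (row q ∷ L) (row q ∷ L')

filled-cap : ∀ {e L L'} → Filled L → ¬ Cap e L L'
filled-cap (row f) (row c) = filled-cap f c

cap-det : ∀ {e e₁ L L' L₁} → Cap e L L' → Cap e₁ L L₁ → e ≡ e₁ × L' ≡ L₁
cap-det (here _) (here _) = refl , refl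
cap-det (here f) (blank c) = ⊥-elim (filled-cap f c)
cap-det (blank c) (here f) = ⊥-elim (filled-cap f c)
cap-det (blank c) (blank c₁) with cap-det c c₁
... | refl , refl = refl , refl
cap-det (row c) (row c₁) with cap-det c c₁
... | refl , refl = refl , refl

cap-inj : ∀ {e e₁ L L₁ L'} → Cap e L L' → Cap e₁ L₁ L' → L ≡ L₁
cap-inj (here _) (here _) = refl
cap-inj (blank c) (blank c₁) = cong (blank ∷_) (cap-inj c c₁)
cap-inj (row c) (row c₁) = cong (row _ ∷_) (cap-inj c c₁)

cap-total : ∀ {L} → Tidy L → Filled L ⊎ (∃₂ λ e L' → Cap e L L' × (∀ y → y < length L → at L y ≡ blank → y ≤ e))
cap-total [] = inj₁ []
cap-total (mark f) = inj₁ (mark f)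
cap-total (blank t) with cap-total t
... | inj₁ f = inj₂ (0 , _ , here f , λ { zero _ _ → z≤n ; (suc y) l e → ⊥-elim (filled-at y f (s≤s⁻¹ l) e) })
... | inj₂ (e , L' , c , h) = inj₂ (suc e , _ , blank c , λ { zero _ _ → z≤n ; (suc y) l e → s≤s (h y (s≤s⁻¹ l) e) })
cap-total (row t) with cap-total t
... | inj₁ f = inj₁ (row f)
... | inj₂ (e , L' , c , h) = inj₂ (suc e , _ , row c , λ { zero _ () ; (suc y) l e → s≤s (h y (s≤s⁻¹ l) e) })

cap-length : ∀ {e L L'} → Cap e L L' → length L' ≡ length L
cap-length (here _) = refl
cap-length (blank c) = cong suc (cap-length c)
cap-length (row c) = cong suc (cap-length c)

cap-< : ∀ {e L L'} → Cap e L L' → e < length L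
cap-< (here _) = z<s
cap-< (blank c) = s≤s (cap-< c)
cap-< (row c) = s≤s (cap-< c)

cap-tidy : ∀ {e L L'} → Cap e L L' → Tidy L'
cap-tidy (here f) = mark f
cap-tidy (blank c) = blank (cap-tidy c)
cap-tidy (row c) = row (cap-tidy c)

cap-tidy⁻ : ∀ {e L L'} → Cap e L L' → Tidy L
cap-tidy⁻ (here f) = blank (filled-tidy f)
cap-tidy⁻ (blank c) = blank (cap-tidy⁻ c)
cap-tidy⁻ (row c) = row (cap-tidy⁻ c)

cap-blank : ∀ {e L L'} → Cap e L L' → at L e ≡ blank
cap-blank (here _) = refl
cap-blank (blank c) = cap-blank c
cap-blank (row c) = cap-blank c

cap-mark : ∀ {e L L'} → Cap e L L' → at L' e ≡ mark
cap-mark (here _) = refl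
cap-mark (blank c) = cap-mark c
cap-mark (row c) = cap-mark c

cap-at : ∀ {e L L'} → Cap e L L' → ∀ y → y ≢ e → at L' y ≡ at L y
cap-at (here _) zero ne = ⊥-elim (ne refl)
cap-at (here _) (suc y) ne = refl
cap-at (blank c) zero ne = refl
cap-at (blank c) (suc y) ne = cap-at c y (ne ∘ cong suc)
cap-at (row c) zero ne = refl
cap-at (row c) (suc y) ne = cap-at c y (ne ∘ cong suc)

cap-N≤ : ∀ {e L L'} → Cap e L L' → ∀ y → y ≤ e → N L' y ≡ N L y
cap-N≤ (here _) zero l = refl
cap-N≤ (blank c) zero l = refl
cap-N≤ (blank c) (suc y) l = cap-N≤ c y (s≤s⁻¹ l)
cap-N≤ (row c) zero l = refl
cap-N≤ (row {zero} c) (suc y) l = cong suc (cap-N≤ c y (s≤s⁻¹ l))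
cap-N≤ (row {suc q} c) (suc y) l = cap-N≤ c y (s≤s⁻¹ l)

cap-N> : ∀ {e L L'} → Cap e L L' → ∀ y → e < y → N L' y ≡ N L e
cap-N> (here _) (suc y) l = refl
cap-N> (blank c) (suc y) l = cap-N> c y (s≤s⁻¹ l)
cap-N> (row {zero} c) (suc y) l = cong suc (cap-N> c y (s≤s⁻¹ l))
cap-N> (row {suc q} c) (suc y) l = cap-N> c y (s≤s⁻¹ l)

cap-N-anti : ∀ {e L L'} → Cap e L L' → ∀ y → N L' y ≤ N L y
cap-N-anti {e} {L} c y with y ≤? e
... | yes l = ≤-reflexive (cap-N≤ c y l)
... | no ¬l = ≤-trans (≤-reflexive (cap-N> c y (≰⇒> ¬l))) (N-mono L (<⇒≤ (≰⇒> ¬l)))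

-- Capping lowers counts only beyond e, where they drop to `N L e`; thresholds up to that value are
-- unaffected.
cap-N-≤ : ∀ {e L L' d r} → Cap e L L' → r ≤ N L e → d ≤ r → ∀ y → d ≤ N L y → d ≤ N L' y
cap-N-≤ {e} {L} {d = d} c r≤ d≤ y h with y ≤? e
... | yes l = subst (d ≤_) (sym (cap-N≤ c y l)) h
... | no ¬l = subst (d ≤_) (sym (cap-N> c y (≰⇒> ¬l))) (≤-trans d≤ r≤)

cap-fwd : ∀ {i b m e ρ L L' ps} → m < ρ 0 + N L e → V i b 0 m ρ L ps → Cap e L L' → V i b 0 m ρ L' (jump ∷ ps)
cap-fwd {m = m} {ρ = ρ} l (blank v) (here f) = jump (subst (m <_) (+-identityʳ (ρ 0)) l) v
cap-fwd l (blank v) (blank c) = blank (cap-fwd l v c)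
cap-fwd {m = m} {e = suc e} {ρ} {row q ∷ L} l (row s v) (row c) =
  row s (cap-fwd (subst (m <_) (sym (N-row q ρ L e)) l) v c)

cap-back : ∀ {i b m ρ L' ps} → Tidy L' → V i b 0 m ρ L' (jump ∷ ps) →
           ∃₂ λ e L → Cap e L L' × m < ρ 0 + N L e × V i b 0 m ρ L ps
cap-back {m = m} {ρ} (mark f) (jump l v) = 0 , _ , here f , subst (m <_) (sym (+-identityʳ (ρ 0))) l , blank v
cap-back (blank t) (blank v) with cap-back t v
... | e , L , c , l , v' = suc e , _ , blank c , l , blank v'
cap-back {m = m} {ρ} (row t) (row {q} s v) with cap-back t v
... | e , L , c , l , v' = suc e , _ , row c , subst (m <_) (N-row q ρ L e) l , row s v'

-- Counting, and words for 12...k(k-1) with their walks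

count : {P : ℕ → Set} → (∀ y → Dec (P y)) → ℕ → ℕ
count P? zero    = 0
count P? (suc n) with P? n
... | yes _ = suc (count P? n)
... | no  _ = count P? n

count-mono : ∀ {P Q : ℕ → Set} (P? : ∀ y → Dec (P y)) (Q? : ∀ y → Dec (Q y)) n →
             (∀ {y} → y < n → P y → Q y) → count P? n ≤ count Q? n
count-mono P? Q? zero h = z≤n
count-mono P? Q? (suc n) h with P? n | Q? n
... | yes p | yes q = s≤s (count-mono P? Q? n (h ∘ m<n⇒m<1+n))
... | yes p | no ¬q = ⊥-elim (¬q (h ≤-refl p))
... | no ¬p | yes q = m≤n⇒m≤1+n (count-mono P? Q? n (h ∘ m<n⇒m<1+n))
... | no ¬p | no ¬q = count-mono P? Q? n (h ∘ m<n⇒m<1+n)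

count-< : ∀ {P Q : ℕ → Set} (P? : ∀ y → Dec (P y)) (Q? : ∀ y → Dec (Q y)) n v →
          (∀ {y} → y < n → P y → Q y) → v < n → Q v → ¬ P v → count P? n < count Q? n
count-< P? Q? (suc n) v h v< qv ¬pv with v ≟ n
... | yes refl with P? n | Q? n
...   | yes p | _ = ⊥-elim (¬pv p)
...   | no _ | no ¬q = ⊥-elim (¬q qv)
...   | no _ | yes _ = s≤s (count-mono P? Q? n (h ∘ m<n⇒m<1+n))
count-< P? Q? (suc n) v h v< qv ¬pv | no ne with count-< P? Q? n v (h ∘ m<n⇒m<1+n) (≤∧≢⇒< (s≤s⁻¹ v<) ne) qv ¬pv
... | lt with P? n | Q? n
...   | yes p | yes q = s≤s lt
...   | yes p | no ¬q = ⊥-elim (¬q (h ≤-refl p))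
...   | no ¬p | yes q = m≤n⇒m≤1+n lt
...   | no ¬p | no ¬q = lt

count-remove : ∀ {P Q : ℕ → Set} (P? : ∀ y → Dec (P y)) (Q? : ∀ y → Dec (Q y)) n s → s < n → P s →
               (∀ {y} → Q y → P y × y ≢ s) → (∀ {y} → P y → y ≢ s → Q y) → count P? n ≡ suc (count Q? n)
count-remove P? Q? (suc n) s s< ps q⇒ p⇒ with s ≟ n
... | yes refl with P? n | Q? n
...   | no ¬p | _ = ⊥-elim (¬p ps)
...   | yes _ | yes q = ⊥-elim (proj₂ (q⇒ q) refl)
...   | yes _ | no _ = cong suc (≤-antisym
          (count-mono P? Q? n (λ y< p → p⇒ p (<⇒≢ y<))) (count-mono Q? P? n (λ _ q → proj₁ (q⇒ q))))
count-remove P? Q? (suc n) s s< ps q⇒ p⇒ | no ne with count-remove P? Q? n s (≤∧≢⇒< (s≤s⁻¹ s<) ne) ps q⇒ p⇒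
... | eq with P? n | Q? n
...   | yes p | yes q = cong suc eq
...   | yes p | no ¬q = ⊥-elim (¬q (p⇒ p (ne ∘ sym)))
...   | no ¬p | yes q = ⊥-elim (¬p (proj₁ (q⇒ q)))
...   | no ¬p | no ¬q = eq

least : ∀ {P : ℕ → Set} (P? : ∀ y → Dec (P y)) n → (∃[ y ] y < n × P y) →
        ∃[ v ] v < n × P v × (∀ {y} → P y → v ≤ y)
least P? (suc n) (y , y< , py) with anyUpTo? P? n
... | yes w with least P? n w
...   | v , v< , pv , m = v , m<n⇒m<1+n v< , pv , m
least P? (suc n) (y , y< , py) | no ¬any = y , y< , py , λ {z} pz → ≤-trans (s≤s⁻¹ y<) (≮⇒≥ λ z<n → ¬any (z , z<n , pz))

blank? : ∀ L y → Dec (at L y ≡ blank)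
blank? L y with at L y
... | blank = yes refl
... | mark  = no λ ()
... | row _ = no λ ()

-- The insertion process for 12…k(k−1), with k = r₀ + 3.
module E (r₀ n : ℕ) where

  -- The top row has at most r entries, and exactly r at marks; the number of rows is free.
  Valid : Cells → List Step → Set
  Valid = V 0 (suc r₀) 0 r₀ (λ _ → 0)

  -- In `high` the letter `v` and the marked cell `e` need not coincide. Nothing records `v`, which
  -- is determined by its minimality.
  data Run : List ℕ → Cells → List Step → Set where
    []   : Run [] (replicate n blank) []
    low  : ∀ {w L L' ps d s} → Run w L ps → s < n → s ∉ w → N L s ≤ r₀ →
           Ins r₀ (down d) s L L' → Run (s ∷ w) L' (down d ∷ ps)
    high : ∀ {w L L' ps e v} → Run w L ps → v < n → v ∉ w → r₀ < N L v →
           (∀ {y} → y < n → y ∉ w → r₀ < N L y → v ≤ y) →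
           Cap e L L' → r₀ < N L e → Run (v ∷ w) L' (jump ∷ ps)

  valid : ∀ {w L ps} → Run w L ps → Valid L ps
  valid [] = V-replicate n
  valid (low r _ _ l i) = ins-fwd (inj₁ refl) (λ _ ()) (λ _ → s≤s l) shape-∅ (valid r) i
  valid (high r _ _ _ _ c l) = cap-fwd l (valid r) c

  run-length : ∀ {w L ps} → Run w L ps → length L ≡ n
  run-length [] = length-replicate n
  run-length (low r _ _ _ i) = trans (ins-length i) (run-length r)
  run-length (high r _ _ _ _ c _) = trans (cap-length c) (run-length r)

  tidy : ∀ {w L ps} → Run w L ps → Tidy L
  tidy [] = tidy-replicate n
  tidy (low r _ _ _ i) = ins-tidy i (tidy r)
  tidy (high r _ _ _ _ c _) = cap-tidy c

  cap-below : ∀ {e L L' y} → Cap e L L' → r₀ < N L e → N L' y ≤ r₀ → N L y ≤ r₀ × y ≢ e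
  cap-below {e} {L} {L'} {y} c l h = small , λ { refl → <⇒≱ l small }
    where
    y≤e = ≮⇒≥ λ e<y → <⇒≱ l (subst (_≤ r₀) (cap-N> c y e<y) h)
    small = subst (_≤ r₀) (cap-N≤ c y y≤e) h

  -- Skipped letters and marks both arise only where the count exceeds r₀. The region with counts up
  -- to r₀ only shrinks in time, so inside it the cells show the used letters faithfully.
  unused : ∀ {w L ps} y → Run w L ps → N L y ≤ r₀ → y ∉ w → at L y ≡ blank
  unused y [] l m = at-replicate n y
  unused y (low r _ _ _ i) l m =
    ins-blank→ y i (m ∘ here) (unused y r (≤-trans (ins-N-mono i y) l) (m ∘ there))
  unused y (high r _ _ _ _ c l') l m with cap-below c l' l
  ... | l₀ , ne = trans (cap-at c y ne) (unused y r l₀ (m ∘ there))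

  unused⁻ : ∀ {w L ps} y → Run w L ps → N L y ≤ r₀ → at L y ≡ blank → y ∉ w
  unused⁻ y (low r _ _ _ i) l e (here refl) = proj₁ (ins-blank← y i e) refl
  unused⁻ y (low r _ _ _ i) l e (there m) =
    unused⁻ y r (≤-trans (ins-N-mono i y) l) (proj₂ (ins-blank← y i e)) m
  unused⁻ y (high r _ _ l₁ _ c l') l e m with cap-below c l' l
  unused⁻ y (high r _ _ l₁ _ c l') l e (here refl) | l₀ , ne = <⇒≱ l₁ l₀
  unused⁻ y (high r _ _ l₁ _ c l') l e (there m) | l₀ , ne =
    unused⁻ y r l₀ (trans (sym (cap-at c y ne)) e) m

  lower-chain : ∀ {w L ps} → Run w L ps → ∀ y d → d < N L y → ∃[ l ] l < y × Inc↑ w (suc d) l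
  lower-chain [] y d h = ⊥-elim (n≮0 (subst (d <_) (N-replicate n y) h))
    where
    N-replicate : ∀ n y → N (replicate n blank) y ≡ 0
    N-replicate zero y = refl
    N-replicate (suc n) zero = refl
    N-replicate (suc n) (suc y) = N-replicate n y
  lower-chain (high r _ _ _ _ c _) y d h with lower-chain r y d (<-≤-trans h (cap-N-anti c y))
  ... | l , l< , ch = l , l< , old ch
  lower-chain (low {L = L} {s = s} r _ _ _ i) y d h with y ≤? s
  ... | yes y≤s with lower-chain r y d (subst (d <_) (ins-N≤ i y y≤s) h)
  ...   | l , l< , ch = l , l< , old ch
  lower-chain (low {L = L} {s = s} r _ _ _ i) y d h | no ¬l with ins-N> i y (≰⇒> ¬l)
  ... | inj₁ e with lower-chain r y d (subst (d <_) e h)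
  ...   | l , l< , ch = l , l< , old ch
  lower-chain (low {L = L} {s = s} r _ _ _ i) y zero h | no ¬l | inj₂ _ = s , ≰⇒> ¬l , new
  lower-chain (low {L = L} {s = s} r _ _ _ i) y (suc d) h | no ¬l | inj₂ (e , e')
    with lower-chain r s d (subst (d <_) e' (s≤s⁻¹ (subst (suc d <_) e h)))
  ... | l , l< , ch = s , ≰⇒> ¬l , ext ch l<

  -- Half of Schensted's theorem for increasing subsequences. It is limited to lengths up to r
  -- because a cut removes the cells behind the mark from the count.
  upper-chain : ∀ {w L ps d l} → Run w L ps → Inc↑ w d l → d ≤ suc r₀ → d ≤ N L (suc l)
  upper-chain (low r _ _ _ i) new h = ≤-trans (s≤s z≤n) (ins-N-suc i)
  upper-chain (low {L = L} r _ _ _ i) (ext c l<s) h =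
    ≤-trans (s≤s (≤-trans (upper-chain r c (≤-trans (n≤1+n _) h)) (N-mono L l<s))) (ins-N-suc i)
  upper-chain (low r _ _ _ i) (old c) h = ≤-trans (upper-chain r c h) (ins-N-mono i _)
  upper-chain (high {L = L} r _ _ l₁ _ c l₂) (old ch) h = cap-N-≤ c l₂ h _ (upper-chain r ch h)
  -- The letter `v` was not inserted, but at least r top entries precede it already.
  upper-chain (high {L = L} {v = v} r _ _ l₁ _ c l₂) new h =
    cap-N-≤ c l₂ h (suc v) (≤-trans h (≤-trans l₁ (N-mono L (n≤1+n v))))
  upper-chain (high {L = L} {v = v} r _ _ l₁ _ c l₂) (ext _ _) h =
    cap-N-≤ c l₂ h (suc v) (≤-trans h (≤-trans l₁ (N-mono L (n≤1+n v))))

  -- Every step uses up one letter and one blank cell, even when a cut makes these two different.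
  counts : ∀ {w L ps} → Run w L ps → count (blank? L) n ≡ count (λ y → y ∉? w) n
  counts [] = ≤-antisym (count-mono (blank? (replicate n blank)) (λ y → y ∉? []) n (λ _ _ ()))
    (count-mono (λ y → y ∉? []) (blank? (replicate n blank)) n (λ {y} _ _ → at-replicate n y))
  counts {s ∷ w} {L'} (low {L = L} r s< s∉ _ i) = suc-injective (trans
    (sym (count-remove (blank? L) (blank? L') n s s< (ins-blank i)
      (λ {y} e → proj₂ (ins-blank← y i e) , proj₁ (ins-blank← y i e)) (λ {y} e ne → ins-blank→ y i ne e)))
    (trans (counts r) (count-remove (λ y → y ∉? w) (λ y → y ∉? (s ∷ w)) n s s< s∉
      (λ m → m ∘ there , m ∘ here) (λ { m ne (here e) → ne e ; m ne (there m') → m m' }))))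
  counts {v ∷ w} {L'} (high {L = L} {e = e} r v< v∉ _ _ c _) = suc-injective (trans
    (sym (count-remove (blank? L) (blank? L') n e (subst (e <_) (run-length r) (cap-< c)) (cap-blank c)
      (λ {y} q → let ne = λ y≡e → nomark (trans (sym (cap-mark c)) (subst (λ z → at L' z ≡ blank) y≡e q))
                 in trans (sym (cap-at c y ne)) q , ne)
      (λ {y} p ne → trans (cap-at c y ne) p)))
    (trans (counts r) (count-remove (λ y → y ∉? w) (λ y → y ∉? (v ∷ w)) n v v< v∉
      (λ m → m ∘ there , m ∘ here) (λ { m ne (here e) → ne e ; m ne (there m') → m m' }))))
    where
    nomark : mark ≢ blank
    nomark ()

  high-blank : ∀ {w L ps v} → Run w L ps → v < n → v ∉ w → r₀ < N L v → ∃[ y ] y < n × at L y ≡ blank × r₀ < N L y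
  high-blank {w} {L} {v = v} r v< v∉ l with anyUpTo? (λ y → blank? L y ×-dec (r₀ <? N L y)) n
  ... | yes p = p
  ... | no ¬any = ⊥-elim (<-irrefl (counts r) (count-< (blank? L) (λ y → y ∉? w) n v
          (λ {y} y< b → unused⁻ y r (≮⇒≥ λ h → ¬any (y , y< , b , h)) b) v< v∉ (λ b → ¬any (v , v< , b , l))))

  blank-high : ∀ {w L ps e} → Run w L ps → e < n → at L e ≡ blank → r₀ < N L e → ∃[ y ] y < n × y ∉ w × r₀ < N L y
  blank-high {w} {L} {e = e} r e< b l with anyUpTo? (λ y → (y ∉? w) ×-dec (r₀ <? N L y)) n
  ... | yes p = p
  ... | no ¬any = ⊥-elim (<-irrefl (sym (counts r)) (count-< (λ y → y ∉? w) (blank? L) n e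
          (λ {y} y< m → unused y r (≮⇒≥ λ h → ¬any (y , y< , m , h)) m) e< b (λ m → ¬any (e , e< , m , l))))

  data Good : List ℕ → Set where
    []   : Good []
    step : ∀ {s w} → Good w → s < n → s ∉ w →
           (∀ {y l} → y < n → y ∉ s ∷ w → y < s → Inc↑ w (suc r₀) l → l < y → ⊥) → Good (s ∷ w)

  good : ∀ {w L ps} → Run w L ps → Good w
  good [] = []
  good (low {L = L} r s< s∉ l i) = step (good r) s< s∉ λ y< y∉ y<s c l<y →
    <⇒≱ (upper-chain r c ≤-refl) (≤-trans (N-mono L (<-trans l<y y<s)) l)
  good (high {L = L} r v< v∉ l m c l') = step (good r) v< v∉ λ y< y∉ y<v ch l<y →
    <⇒≱ y<v (m y< (y∉ ∘ there) (≤-trans (upper-chain r ch ≤-refl) (N-mono L l<y)))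

  encode : ∀ {w} → Good w → ∃₂ λ L ps → Run w L ps
  encode [] = _ , _ , []
  encode (step {s} g s< s∉ ok) with encode g
  ... | L , ps , r with N L s ≤? r₀
  ...   | yes l with ins-total r₀ (tidy-free s (tidy r) (subst (s <_) (sym (run-length r)) s<) (unused s r l s∉))
  ...     | d , L' , i = _ , _ , low r s< s∉ l i
  encode (step {s} g s< s∉ ok) | L , ps , r | no ¬l with high-blank r s< s∉ (≰⇒> ¬l) | cap-total (tidy r)
  ... | y , y< , b , _ | inj₁ f = ⊥-elim (filled-at y f (subst (y <_) (sym (run-length r)) y<) b)
  ... | y , y< , b , h | inj₂ (e , L' , c , last) = _ , _ , high r s< s∉ (≰⇒> ¬l) least-s c
          (<-≤-trans h (N-mono L (last y (subst (y <_) (sym (run-length r)) y<) b)))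
    where
    least-s : ∀ {y} → y < n → y ∉ _ → r₀ < N L y → s ≤ y
    least-s {y} y< y∉ h = ≮⇒≥ λ y<s → let l , l< , ch = lower-chain r y r₀ h in
      ok y< (λ { (here refl) → <-irrefl refl y<s ; (there m) → y∉ m }) y<s ch l<

  decode : ∀ {L} ps → length L ≡ n → Tidy L → Valid L ps → ∃[ w ] Run w L ps
  decode [] e t v with V-[] v
  ... | _ , eq = [] , subst (λ L → Run [] L []) (sym (trans eq (cong (λ k → replicate k blank) e))) []
  decode (down d ∷ ps) e t v with ins-back {r₀ = r₀} (λ ()) t v
  ... | s , L₀ , i , v₀ with decode ps (trans (sym (ins-length i)) e) (ins-tidy⁻ i t) v₀
  ...   | w , r = s ∷ w , low r s< (unused⁻ s r l (ins-blank i)) l i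
    where
    s< = subst (s <_) (run-length r) (ins-< i)
    l = s≤s⁻¹ (low-bound v i)
  decode (jump ∷ ps) e t v with cap-back t v
  ... | x , L₀ , c , l , v₀ with decode ps (trans (sym (cap-length c)) e) (cap-tidy⁻ c) v₀
  -- The mark says only that some letter was skipped. The blank cell `x` guarantees a candidate, and
  -- `high` demands the least one.
  ...   | w , r with least (λ y → (y ∉? w) ×-dec (r₀ <? N L₀ y)) n
                     (blank-high r (subst (x <_) (run-length r) (cap-< c)) (cap-blank c) l)
  ...     | u , u< , (u∉ , h) , m = u ∷ w , high r u< u∉ h (λ _ y∉ h' → m (y∉ , h')) c l

  det : ∀ {w L L₁ ps ps₁} → Run w L ps → Run w L₁ ps₁ → L ≡ L₁ × ps ≡ ps₁
  det [] [] = refl , refl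
  det (low r _ _ _ i) (low r₁ _ _ _ i₁) with det r r₁
  ... | refl , refl with ins-down-det i i₁
  ...   | refl , refl = refl , refl
  det (low r _ _ l _) (high r₁ _ _ h _ _ _) with det r r₁
  ... | refl , refl = ⊥-elim (<⇒≱ h l)
  det (high r _ _ h _ _ _) (low r₁ _ _ l _) with det r r₁
  ... | refl , refl = ⊥-elim (<⇒≱ h l)
  det (high r _ _ _ _ c _) (high r₁ _ _ _ _ c₁ _) with det r r₁
  ... | refl , refl with cap-det c c₁
  ...   | refl , refl = refl , refl

  inj : ∀ {w w₁ L ps} → Run w L ps → Run w₁ L ps → w ≡ w₁
  inj [] [] = refl
  inj (low r _ _ _ i) (low r₁ _ _ _ i₁) with ins-inj i i₁
  ... | refl , refl = cong (_ ∷_) (inj r r₁)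
  inj (high r v< v∉ h m c _) (high r₁ v₁< v₁∉ h₁ m₁ c₁ _) with cap-inj c c₁
  ... | refl with inj r r₁
  ...   | refl = cong (_∷ _) (≤-antisym (m v₁< v₁∉ h₁) (m₁ v< v∉ h))

-- Descents read off the cells

data Before : List ℕ → ℕ → ℕ → Set where
  here  : ∀ {w a b} → a ∈ w → Before (b ∷ w) a b
  there : ∀ {w a b c} → Before w a b → Before (c ∷ w) a b

before-∈ʳ : ∀ {w a b} → Before w a b → b ∈ w
before-∈ʳ (here _) = here refl
before-∈ʳ (there p) = there (before-∈ʳ p)

before-∈ˡ : ∀ {w a b} → Before w a b → a ∈ w
before-∈ˡ (here m) = there m
before-∈ˡ (there p) = there (before-∈ˡ p)

before-head : ∀ {w a b} → b ∉ w → Before (b ∷ w) a b → a ∈ w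
before-head b∉ (here m) = m
before-head b∉ (there p) = ⊥-elim (b∉ (before-∈ʳ p))

before-tail : ∀ {w a b c} → b ≢ c → Before (c ∷ w) a b → Before w a b
before-tail ne (here _) = ⊥-elim (ne refl)
before-tail ne (there p) = p

Iff : Set → Set → Set
Iff A B = (A → B) × (B → A)

ins-before : ∀ {r₀ p s L L'} i → Ins r₀ p s L L' → i < s → at L' i ≡ at L i × at L i ≢ mark
ins-before zero (blank is) l = refl , λ ()
ins-before (suc i) (blank is) l = ins-before i is (s≤s⁻¹ l)
ins-before zero (row is) l = refl , λ ()
ins-before (suc i) (row is) l = ins-before i is (s≤s⁻¹ l)

-- Moving an entry from row c to c + 1 could upset a comparison only with a right neighbour in row c
-- + 1, which is then hit in turn, or with a left neighbour in row c, which would have been hit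
-- instead.
bump-drop : ∀ {r₀ d c L L'} i → Bump r₀ (down d) c L L' →
            Iff (Drop (at L i) (at L (suc i))) (Drop (at L' i) (at L' (suc i)))
bump-drop i (base (stay _)) = id , id
bump-drop zero (skip (base (stay _))) = id , id
bump-drop zero (skip (skip b)) = id , id
bump-drop zero (skip (hit b)) = id , id
bump-drop zero (skip (pass x b)) = id , id
bump-drop (suc i) (skip b) = bump-drop i b
bump-drop zero (hit (base (stay []))) = id , id
bump-drop zero (hit (base (stay mark))) = id , id
bump-drop zero (hit (skip b)) = id , id
bump-drop zero (hit (hit b)) = s≤s , s≤s⁻¹
bump-drop zero (hit (pass ne b)) = (λ l → ≤∧≢⇒< l (ne ∘ sym)) , <-trans (n<1+n _)
bump-drop (suc i) (hit b) = bump-drop i b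
bump-drop zero (pass x (base (stay []))) = id , id
bump-drop zero (pass x (base (stay mark))) = id , id
bump-drop zero (pass x (skip b)) = id , id
bump-drop zero (pass x (hit b)) = m<n⇒m<1+n , λ l → ≤∧≢⇒< (s≤s⁻¹ l) x
bump-drop zero (pass x (pass x₁ b)) = id , id
bump-drop (suc i) (pass x b) = bump-drop i b

-- For i = s, a neighbour that meets carry 0 leaves the scan below the top row, in accordance with
-- the value of `Drop` at a blank. The pair with suc i = s is only decided at this moment.
ins-drop : ∀ {r₀ d s L L'} i → Ins r₀ (down d) s L L' → suc i ≢ s →
           Iff (Drop (at L i) (at L (suc i))) (Drop (at L' i) (at L' (suc i)))
ins-drop zero (here (base (stay []))) ne = id , id
ins-drop zero (here (base (stay mark))) ne = id , id
ins-drop zero (here (skip b)) ne = id , id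
ins-drop zero (here (hit b)) ne = (λ _ → z<s) , (λ _ → tt)
ins-drop zero (here (pass x b)) ne = (λ _ → n≢0⇒n>0 x) , (λ _ → tt)
ins-drop (suc i) (here b) ne = bump-drop i b
ins-drop zero (blank (here b)) ne = ⊥-elim (ne refl)
ins-drop zero (blank (blank is)) ne = id , id
ins-drop zero (blank (row is)) ne = id , id
ins-drop (suc i) (blank is) ne = ins-drop i is (ne ∘ cong suc)
ins-drop zero (row (here b)) ne = ⊥-elim (ne refl)
ins-drop zero (row (blank is)) ne = id , id
ins-drop zero (row (row is)) ne = id , id
ins-drop (suc i) (row is) ne = ins-drop i is (ne ∘ cong suc)

-- `Drop` treats a mark exactly like a blank.
cap-drop : ∀ {e L L'} i → Cap e L L' →
           Iff (Drop (at L i) (at L (suc i))) (Drop (at L' i) (at L' (suc i)))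
cap-drop zero (here []) = id , id
cap-drop zero (here (row f)) = id , id
cap-drop zero (here (mark f)) = id , id
cap-drop (suc i) (here f) = id , id
cap-drop zero (blank (here f)) = id , id
cap-drop zero (blank (blank c)) = id , id
cap-drop zero (blank (row c)) = id , id
cap-drop (suc i) (blank c) = cap-drop i c
cap-drop zero (row (here f)) = id , id
cap-drop zero (row (blank c)) = id , id
cap-drop zero (row (row c)) = id , id
cap-drop (suc i) (row c) = cap-drop i c

drop-row : ∀ a {b} → Drop a b → ∃[ y ] b ≡ row y
drop-row blank   {row y} d = y , refl
drop-row mark    {row y} d = y , refl
drop-row (row x) {row y} d = y , refl

-- A mark replaces an entry of row r₀, the lowest one allowed: a right neighbour is never lower, and
-- a left neighbour in the scan is strictly higher, as `Rise` has it for marks.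
bump-rise : ∀ {r₀ p c L L'} i → Rows r₀ L → Bump r₀ p c L L' →
            Iff (Rise (at L i) (at L (suc i))) (Rise (at L' i) (at L' (suc i)))
bump-rise i h (base (stay _)) = id , id
bump-rise zero h (base (cut [])) = id , id
bump-rise zero h (base (cut (row f))) = (λ _ → tt) , (λ _ → h 1 refl)
bump-rise zero h (base (cut (mark f))) = id , id
bump-rise (suc i) h (base (cut f)) = id , id
bump-rise zero h (skip b) = id , id
bump-rise (suc i) h (skip b) = bump-rise i (h ∘ suc) b
bump-rise zero h (hit (base (stay []))) = id , id
bump-rise zero h (hit (base (stay mark))) = id , id
bump-rise zero h (hit (base (cut f))) = 1+n≰n , λ ()
bump-rise zero h (hit (skip b)) = id , id
bump-rise zero h (hit (hit b)) = (⊥-elim ∘ 1+n≰n) , (⊥-elim ∘ 1+n≰n)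
bump-rise zero h (hit (pass ne b)) = m≤n⇒m≤1+n , λ l → s≤s⁻¹ (≤∧≢⇒< l ne)
bump-rise (suc i) h (hit b) = bump-rise i (h ∘ suc) b
bump-rise zero h (pass x (base (stay []))) = id , id
bump-rise zero h (pass x (base (stay mark))) = id , id
bump-rise zero h (pass x (base (cut f))) = (λ l → x (≤-antisym (h 0 refl) l)) , λ ()
bump-rise zero h (pass x (skip b)) = id , id
bump-rise zero h (pass x (hit b)) = (λ l → ≤∧≢⇒< l (x ∘ sym)) , <⇒≤
bump-rise zero h (pass x (pass y b)) = id , id
bump-rise (suc i) h (pass x b) = bump-rise i (h ∘ suc) b

ins-rise : ∀ {r₀ p s L L'} i → Rows r₀ L → Ins r₀ p s L L' → suc i ≢ s →
           Iff (Rise (at L i) (at L (suc i))) (Rise (at L' i) (at L' (suc i)))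
ins-rise zero h (here (base (stay []))) ne = id , id
ins-rise zero h (here (base (stay mark))) ne = id , id
ins-rise zero h (here (base (cut f))) ne = id , id
ins-rise zero h (here (skip b)) ne = id , id
ins-rise zero h (here (hit b)) ne = (λ ()) , λ ()
ins-rise zero h (here (pass x b)) ne = (λ ()) , λ l → x (n≤0⇒n≡0 l)
ins-rise (suc i) h (here b) ne = bump-rise i (h ∘ suc) b
ins-rise zero h (blank is) ne = id , id
ins-rise (suc i) h (blank is) ne = ins-rise i (h ∘ suc) is (ne ∘ cong suc)
ins-rise zero h (row (here b)) ne = ⊥-elim (ne refl)
ins-rise zero h (row (blank is)) ne = id , id
ins-rise zero h (row (row is)) ne = id , id
ins-rise (suc i) h (row is) ne = ins-rise i (h ∘ suc) is (ne ∘ cong suc)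

module _ {r₀ n : ℕ} where

  open E r₀ n

  row-used : ∀ {w L ps q} y → Run w L ps → at L y ≡ row q → y ∈ w
  row-used y [] e with trans (sym e) (at-replicate n y)
  ... | ()
  row-used y (low r _ _ _ i) e with ins-row⁻ {z = y} i e
  ... | inj₁ refl = here refl
  ... | inj₂ (_ , e') = there (row-used y r e')
  row-used y (high {e = x} r _ _ _ _ c _) e with y ≟ x
  ... | yes refl with trans (sym e) (cap-mark c)
  ...   | ()
  row-used y (high {e = x} r _ _ _ _ c _) e | no ne = there (row-used y r (trans (sym (cap-at c y ne)) e))

  E-drop : ∀ {w L ps} i → Run w L ps → suc i ∈ w →
           (Before w i (suc i) × ¬ Drop (at L i) (at L (suc i)))
           ⊎ (¬ Before w i (suc i) × Drop (at L i) (at L (suc i)))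
  E-drop i (low {L = L} {s = s} r s< s∉ l is) m with suc i ≟ s
  E-drop i (low {L = L} {L'} {s = s} r s< s∉ l is) m | yes refl
    rewrite ins-at is | proj₁ (ins-before i is ≤-refl) with at L i in e
  ... | blank = inj₂ ((λ b → unused⁻ i r (≤-trans (N-mono L (n≤1+n i)) l) e (before-head s∉ b)) , tt)
  ... | mark  = ⊥-elim (proj₂ (ins-before i is ≤-refl) e)
  ... | row x = inj₁ (here (row-used i r e) , λ ())
  E-drop i (low r s< s∉ l is) (here e) | no ne = ⊥-elim (ne e)
  E-drop i (low r s< s∉ l is) (there m) | no ne with E-drop i r m | ins-drop i is ne
  ... | inj₁ (b , d) | f , g = inj₁ (there b , d ∘ g)
  ... | inj₂ (b , d) | f , g = inj₂ (b ∘ before-tail ne , f d)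
  E-drop i (high {v = v} r v< v∉ h least c l) m with suc i ≟ v
  E-drop i (high {L = L} {L'} {e = x} r v< v∉ h least c l) m | yes refl = inj₁ (here i∈ , ¬drop)
    where
    i∈ : i ∈ _
    i∈ with N L i ≤? r₀
    ... | yes l₁ = row-used i r (N-jump L i (≤-<-trans l₁ h))
    ... | no ¬l = decidable-stable (i ∈? _) λ i∉ → <-irrefl refl (least (<-trans (n<1+n i) v<) i∉ (≰⇒> ¬l))
    ¬drop : ¬ Drop (at L' i) (at L' (suc i))
    ¬drop d with drop-row (at L i) (proj₂ (cap-drop i c) d)
    ... | y , e = v∉ (row-used (suc i) r e)
  E-drop i (high r _ _ _ _ c _) (here e) | no ne = ⊥-elim (ne e)
  E-drop i (high r _ _ _ _ c _) (there m) | no ne with E-drop i r m | cap-drop i c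
  ... | inj₁ (b , d) | f , g = inj₁ (there b , d ∘ g)
  ... | inj₂ (b , d) | f , g = inj₂ (b ∘ before-tail ne , f d)

module _ {r₀ n : ℕ} where

  open G r₀ n

  G-rise : ∀ {w L ps} i → Run w L ps → suc i ∈ w →
           (Before w i (suc i) × Rise (at L i) (at L (suc i)))
           ⊎ (¬ Before w i (suc i) × ¬ Rise (at L i) (at L (suc i)))
  G-rise i (step {s = s} r s< s∉ sh is) m with suc i ≟ s
  G-rise i (step {w} {L} r s< s∉ sh is) m | yes refl
    rewrite ins-at is | proj₁ (ins-before i is ≤-refl) with at L i in e
  ... | blank = inj₂ (unused⁻ i r e ∘ before-head s∉ , id)
  ... | mark  = ⊥-elim (proj₂ (ins-before i is ≤-refl) e)
  ... | row x = inj₁ (here (decidable-stable (i ∈? w) λ i∉ → norow (trans (sym e) (unused i r i∉))) , z≤n)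
    where
    norow : row x ≢ blank
    norow ()
  G-rise i (step r s< s∉ sh is) (here e) | no ne = ⊥-elim (ne e)
  G-rise i (step r s< s∉ sh is) (there m) | no ne with G-rise i r m | ins-rise i (rows r) is ne
  ... | inj₁ (b , d) | f , g = inj₁ (there b , f d)
  ... | inj₂ (b , d) | f , g = inj₂ (b ∘ before-tail ne , d ∘ g)

-- Permutations and their words

val : ∀ {m n} → Vec (Fin m) n → ℕ → ℕ
val []      s       = 0
val (x ∷ v) zero    = toℕ x
val (x ∷ v) (suc s) = val v s

val-lookup : ∀ {m n} (v : Vec (Fin m) n) i → val v (toℕ i) ≡ toℕ (lookup v i)
val-lookup (x ∷ v) Fin.zero    = refl
val-lookup (x ∷ v) (Fin.suc i) = val-lookup v i

val-fromℕ< : ∀ {m n s} (v : Vec (Fin m) n) (l : s < n) → val v s ≡ toℕ (lookup v (fromℕ< l))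
val-fromℕ< v l = trans (cong (val v) (sym (Fin.toℕ-fromℕ< l))) (val-lookup v (fromℕ< l))

val-< : ∀ {m n s} (v : Vec (Fin m) n) → s < n → val v s < m
val-< v l = subst (_< _) (sym (val-fromℕ< v l)) (Fin.toℕ<n _)

val-inj : ∀ {m n s t} (v : Vec (Fin m) n) → Injective _≡_ _≡_ (lookup v) → s < n → t < n → val v s ≡ val v t → s ≡ t
val-inj v inj l l' e = trans (sym (Fin.toℕ-fromℕ< l)) (trans (cong toℕ (inj (Fin.toℕ-injective
  (trans (sym (val-fromℕ< v l)) (trans e (val-fromℕ< v l')))))) (Fin.toℕ-fromℕ< l'))

surjective : ∀ {n} (f : Fin n → Fin n) → Injective _≡_ _≡_ f → ∀ j → ∃[ i ] f i ≡ j
surjective {suc n} f inj j with Fin.any? (λ i → f i Fin.≟ j)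
... | yes p = p
... | no ¬p = ⊥-elim (1+n≰n (Fin.injective⇒≤ {f = λ i → punchOut (λ e → ¬p (i , sym e))}
                (λ {x} {y} e → inj (Fin.punchOut-injective (λ h → ¬p (x , sym h)) (λ h → ¬p (y , sym h)) e))))

val-surj : ∀ {n t} (v : Vec (Fin n) n) → Injective _≡_ _≡_ (lookup v) → t < n → ∃[ s ] s < n × val v s ≡ t
val-surj v inj l with surjective (lookup v) inj (fromℕ< l)
... | i , e = toℕ i , Fin.toℕ<n i , trans (val-lookup v i) (trans (cong toℕ e) (Fin.toℕ-fromℕ< l))

-- The word of a permutation lists the positions of the values 0, 1, 2, …, the latest one at the head.
data Spells {n} (v : Vec (Fin n) n) : List ℕ → Set where
  []  : Spells v []
  _∷_ : ∀ {s w} → (s < n × val v s ≡ length w) → Spells v w → Spells v (s ∷ w)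

data Distinct (n : ℕ) : List ℕ → Set where
  []  : Distinct n []
  _∷_ : ∀ {s w} → (s < n × s ∉ w) → Distinct n w → Distinct n (s ∷ w)

module _ {n : ℕ} {v : Vec (Fin n) n} where

  spells-∈ : ∀ {w s} → Spells v w → s ∈ w → s < n × val v s < length w
  spells-∈ ((l , e) ∷ sp) (here refl) = l , s≤s (≤-reflexive e)
  spells-∈ (_ ∷ sp) (there m) with spells-∈ sp m
  ... | l , h = l , m<n⇒m<1+n h

  spells-∉ : ∀ {s w} → Spells v (s ∷ w) → s ∉ w
  spells-∉ ((_ , e) ∷ sp) m = <-irrefl e (proj₂ (spells-∈ sp m))

  spells-distinct : ∀ {w} → Spells v w → Distinct n w
  spells-distinct [] = []
  spells-distinct sp@((l , _) ∷ sp') = (l , spells-∉ sp) ∷ spells-distinct sp'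

  module _ (inj : Injective _≡_ _≡_ (lookup v)) where

    ∈-spells : ∀ {w s} → Spells v w → s < n → val v s < length w → s ∈ w
    ∈-spells {x ∷ w} {s} ((x< , e) ∷ sp) s< l with val v s ≟ length w
    ... | yes eq = here (val-inj v inj s< x< (trans eq (sym e)))
    ... | no ne = there (∈-spells sp s< (≤∧≢⇒< (s≤s⁻¹ l) ne))

    ∉-spells : ∀ {w s} → Spells v w → s < n → s ∉ w → length w ≤ val v s
    ∉-spells sp s< ∉w = ≮⇒≥ (∉w ∘ ∈-spells sp s<)

    spells-unique : ∀ {w w'} → Spells v w → Spells v w' → length w ≡ length w' → w ≡ w'
    spells-unique [] [] e = refl
    spells-unique ((l , e) ∷ sp) ((l' , e') ∷ sp') eq =
      cong₂ _∷_ (val-inj v inj l l' (trans e (trans (suc-injective eq) (sym e')))) (spells-unique sp sp' (suc-injective eq))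

    before-val : ∀ {w a b} → Spells v w → Before w a b → val v a < val v b
    before-val ((_ , e) ∷ sp) (here m) = subst (_ <_) (sym e) (proj₂ (spells-∈ sp m))
    before-val (_ ∷ sp) (there b) = before-val sp b

    val-before : ∀ {w a b} → Spells v w → a < n → b < n → val v b < length w → val v a < val v b → Before w a b
    val-before {x ∷ w} {a} {b} ((x< , e) ∷ sp) a< b< l h with val v b ≟ length w
    ... | no ne = there (val-before sp a< b< (≤∧≢⇒< (s≤s⁻¹ l) ne) h)
    ... | yes eq with val-inj v inj b< x< (trans eq (sym e))
    ...   | refl = here (∈-spells sp a< (subst (val v a <_) eq h))

    spell : ∀ m → m ≤ n → ∃[ w ] Spells v w × length w ≡ m
    spell zero l = [] , [] , refl
    spell (suc m) l with spell m (≤-trans (n≤1+n m) l) | val-surj v inj l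
    ... | w , sp , e | s , s< , eq = s ∷ w , (s< , trans eq (sym e)) ∷ sp , cong suc e

spells-injective : ∀ {n w} {v v' : Vec (Fin n) n} → Injective _≡_ _≡_ (lookup v) →
                   Spells v w → Spells v' w → length w ≡ n → v ≡ v'
spells-injective {n} {w} {v} {v'} inj sp sp' e =
  trans (sym (tabulate∘lookup v)) (trans (tabulate-cong λ i → Fin.toℕ-injective (trans (sym (val-lookup v i))
    (trans (same sp sp' (∈-spells inj sp (Fin.toℕ<n i) (subst (val v (toℕ i) <_) (sym e) (val-< v (Fin.toℕ<n i)))))
      (val-lookup v' i)))) (tabulate∘lookup v'))
  where
  same : ∀ {w s} → Spells v w → Spells v' w → s ∈ w → val v s ≡ val v' s
  same ((_ , e) ∷ _) ((_ , e') ∷ _) (here refl) = trans e (sym e')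
  same (_ ∷ sp) (_ ∷ sp') (there m) = same sp sp' m

-- The number of letters read before s, which is the value at position s. The default is met only
-- for letters outside the word.
time : List ℕ → ℕ → ℕ
time []      s = 0
time (x ∷ w) s with s ≟ x
... | yes _ = length w
... | no  _ = time w s

time-< : ∀ {w s} → s ∈ w → time w s < length w
time-< {x ∷ w} {s} m with s ≟ x | m
... | yes _ | _ = ≤-refl
... | no ne | here e = ⊥-elim (ne e)
... | no ne | there m' = m<n⇒m<1+n (time-< m')

time-inj : ∀ {w s t} → s ∈ w → t ∈ w → time w s ≡ time w t → s ≡ t
time-inj {x ∷ w} {s} {t} m m' e with s ≟ x | t ≟ x | m | m'
... | yes refl | yes refl | _ | _ = refl
... | yes _ | no ne | _ | here e' = ⊥-elim (ne e')
... | yes _ | no _ | _ | there m₂ = ⊥-elim (<-irrefl (sym e) (time-< m₂))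
... | no ne | yes _ | here e' | _ = ⊥-elim (ne e')
... | no _ | yes _ | there m₁ | _ = ⊥-elim (<-irrefl e (time-< m₁))
... | no ne | no _ | here e' | _ = ⊥-elim (ne e')
... | no _ | no ne | there _ | here e' = ⊥-elim (ne e')
... | no _ | no _ | there m₁ | there m₂ = time-inj m₁ m₂ e

module _ {n : ℕ} (w : List ℕ) (dist : Distinct n w) (len : length w ≡ n) (all : ∀ {s} → s < n → s ∈ w) where

  private
    time-bound : ∀ i → time w (toℕ {n} i) < n
    time-bound i = subst (time w (toℕ i) <_) len (time-< (all (Fin.toℕ<n i)))

  unspell : Vec (Fin n) n
  unspell = tabulate λ i → fromℕ< (time-bound i)

  private
    val-unspell : ∀ {s} → s < n → val unspell s ≡ time w s
    val-unspell {s} l = trans (val-fromℕ< unspell l) (trans (cong toℕ (lookup∘tabulate _ (fromℕ< l)))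
      (trans (Fin.toℕ-fromℕ< _) (cong (time w) (Fin.toℕ-fromℕ< l))))

  unspell-injective : Injective _≡_ _≡_ (lookup unspell)
  unspell-injective {i} {j} e = Fin.toℕ-injective (time-inj (all (Fin.toℕ<n i)) (all (Fin.toℕ<n j))
    (trans (sym (val-unspell (Fin.toℕ<n i))) (trans (trans (val-lookup unspell i) (trans (cong toℕ e) (sym (val-lookup unspell j))))
      (val-unspell (Fin.toℕ<n j)))))

  spells-unspell : Spells unspell w
  spells-unspell = go w dist λ { s l m → val-unspell l }
    where
    go : ∀ w' → Distinct n w' → (∀ s → s < n → s ∈ w' → val unspell s ≡ time w' s) → Spells unspell w'
    go [] _ _ = []
    go (x ∷ w') ((x< , x∉) ∷ d) h = (x< , trans (h x x< (here refl)) head) ∷ go w' d tail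
      where
      head : time (x ∷ w') x ≡ length w'
      head with x ≟ x
      ... | yes _ = refl
      ... | no ne = ⊥-elim (ne refl)
      tail : ∀ s → s < n → s ∈ w' → val unspell s ≡ time w' s
      tail s l m with s ≟ x | h s l (there m)
      ... | yes refl | _ = ⊥-elim (x∉ m)
      ... | no _ | eq = eq

count-none : ∀ {P : ℕ → Set} (P? : ∀ y → Dec (P y)) n → (∀ {y} → y < n → ¬ P y) → count P? n ≡ 0
count-none P? zero h = refl
count-none P? (suc n) h with P? n
... | yes p = ⊥-elim (h ≤-refl p)
... | no _ = count-none P? n (h ∘ m<n⇒m<1+n)

count-all : ∀ {P : ℕ → Set} (P? : ∀ y → Dec (P y)) n → (∀ {y} → y < n → P y) → count P? n ≡ n
count-all P? zero h = refl
count-all P? (suc n) h with P? n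
... | yes p = cong suc (count-all P? n (h ∘ m<n⇒m<1+n))
... | no ¬p = ⊥-elim (¬p (h ≤-refl))

distinct-count : ∀ {n w} → Distinct n w → count (λ y → y ∉? w) n + length w ≡ n
distinct-count {n} [] = trans (+-identityʳ _) (count-all (λ y → y ∉? []) n λ _ ())
distinct-count {n} {s ∷ w} ((s< , s∉) ∷ d) = trans (+-suc _ (length w)) (trans (cong (_+ length w)
  (sym (count-remove (λ y → y ∉? w) (λ y → y ∉? (s ∷ w)) n s s< s∉
    (λ m → m ∘ there , m ∘ here) (λ { m ne (here e) → ne e ; m ne (there m') → m m' })))) (distinct-count d))

distinct-length : ∀ {n w} → Distinct n w → (∀ {s} → s < n → s ∈ w) → length w ≡ n
distinct-length {n} {w} d all = trans (cong (_+ length w) (sym (count-none (λ y → y ∉? w) n λ l m → m (all l)))) (distinct-count d)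

flip : ∀ {n} → Vec (Fin n) n → Vec (Fin n) n
flip = Vec.map opposite

flip-flip : ∀ {n} (v : Vec (Fin n) n) → flip (flip v) ≡ v
flip-flip v = trans (sym (map-∘ opposite opposite v)) (trans (map-cong Fin.opposite-involutive v) (map-id v))

flip-injective : ∀ {n} {v : Vec (Fin n) n} → Injective _≡_ _≡_ (lookup v) → Injective _≡_ _≡_ (lookup (flip v))
flip-injective {v = v} inj {i} {j} e = inj (trans (sym (Fin.opposite-involutive _)) (trans (cong opposite
  (trans (sym (lookup-map i opposite v)) (trans e (lookup-map j opposite v)))) (Fin.opposite-involutive _)))

flip-< : ∀ {n s t} (v : Vec (Fin n) n) → s < n → t < n → val v s < val v t → val (flip v) t < val (flip v) s
flip-< {n} {s} {t} v s< t< l = subst₂ _<_ (sym (eq t<)) (sym (eq s<))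
  (∸-monoʳ-< (s≤s l) (val-< v t<))
  where
  eq : ∀ {s} → s < n → val (flip v) s ≡ n ∸ suc (val v s)
  eq {s} l = trans (val-fromℕ< (flip v) l) (trans (cong toℕ (lookup-map (fromℕ< l) opposite v))
    (trans (Fin.opposite-prop (lookup v (fromℕ< l))) (cong (λ x → n ∸ suc x) (sym (val-fromℕ< v l)))))

flip-<⁻ : ∀ {n s t} (v : Vec (Fin n) n) → s < n → t < n → val (flip v) t < val (flip v) s → val v s < val v t
flip-<⁻ {n} {s} {t} v s< t< l = subst (λ u → val u s < val u t) (flip-flip v) (flip-< (flip v) t< s< l)

-- Pattern occurrences and subsequences of the word

ascending : ∀ {k} (f : ℕ → ℕ) → (∀ i → suc i < k → f i < f (suc i)) → ∀ {i j} → i < j → j < k → f i < f j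
ascending f h {i} {suc j} i<j j<k with i ≟ j
... | yes refl = h i j<k
... | no ne = <-trans (ascending f h (≤∧≢⇒< (s≤s⁻¹ i<j) ne) (<-trans (n<1+n j) j<k)) (h j j<k)

snoc : (ℕ → ℕ) → ℕ → ℕ → ℕ → ℕ
snoc c d s i with i <? d
... | yes _ = c i
... | no  _ = s

snoc-< : ∀ c {d} s {i} → i < d → snoc c d s i ≡ c i
snoc-< c {d} s {i} l with i <? d
... | yes _ = refl
... | no ¬l = ⊥-elim (¬l l)

snoc-≡ : ∀ c d s → snoc c d s d ≡ s
snoc-≡ c d s with d <? d
... | yes l = ⊥-elim (<-irrefl refl l)
... | no _ = refl

snoc-step : ∀ {c d s} (R : ℕ → ℕ → Set) → (∀ i → suc i < d → R (c i) (c (suc i))) → (∀ i → suc i ≡ d → R (c i) s) →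
            ∀ i → suc i < suc d → R (snoc c d s i) (snoc c d s (suc i))
snoc-step {c} {d} {s} R h last i l with suc i <? d
... | yes l' = subst (λ x → R x (c (suc i))) (sym (snoc-< c s (<-trans (n<1+n i) l'))) (h i l')
... | no ¬l with ≤-antisym (s≤s⁻¹ l) (≮⇒≥ ¬l)
...   | refl = subst (λ x → R x s) (sym (snoc-< c s (n<1+n i))) (last i refl)

snoc-all : ∀ {c d s} (P : ℕ → Set) → (∀ i → i < d → P (c i)) → P s → ∀ i → i < suc d → P (snoc c d s i)
snoc-all {c} {d} {s} P h ps i l with i <? d
... | yes l' = h i l'
... | no _ = ps

module _ {n k : ℕ} {v : Vec (Fin n) n} {τ : Fin k → ℕ} where

  -- Preserving the order of the pattern suffices: `τ` is injective, so trichotomy gives the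
  -- converse.
  contains : Injective _≡_ _≡_ τ → (p : ℕ → ℕ) → (∀ i → i < k → p i < n) → (∀ i → suc i < k → p i < p (suc i)) →
             (∀ a b → τ a < τ b → val v (p (toℕ a)) < val v (p (toℕ b))) → Contains v τ
  contains τ-inj p p< asc vals = e , increasing , λ a b → mk⇔ (back a b) (λ h → subst₂ _<_ (eq a) (eq b) (vals a b h))
    where
    e : Fin k → Fin n
    e a = fromℕ< (p< (toℕ a) (Fin.toℕ<n a))
    eq : ∀ a → val v (p (toℕ a)) ≡ toℕ (lookup v (e a))
    eq a = val-fromℕ< v (p< (toℕ a) (Fin.toℕ<n a))
    increasing : ∀ a b → a Fin.< b → e a Fin.< e b
    increasing a b l = subst₂ _<_ (sym (Fin.toℕ-fromℕ< _)) (sym (Fin.toℕ-fromℕ< _)) (ascending p asc l (Fin.toℕ<n b))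
    back : ∀ a b → lookup v (e a) Fin.< lookup v (e b) → τ a < τ b
    back a b h with <-cmp (τ a) (τ b)
    ... | tri< l _ _ = l
    ... | tri≈ _ eq′ _ = ⊥-elim (<-irrefl (cong (toℕ ∘ lookup v ∘ e) (τ-inj eq′)) h)
    ... | tri> _ _ l = ⊥-elim (<-asym h (subst₂ _<_ (eq b) (eq a) (vals b a l)))

  occurrence : Contains v τ → Σ[ p ∈ (ℕ → ℕ) ] (∀ i → i < k → p i < n) × (∀ i j → i < j → j < k → p i < p j) ×
               (∀ a b → τ a < τ b → val v (p (toℕ a)) < val v (p (toℕ b)))
  occurrence (e , inc-e , vals) = p , p< , p-asc , λ a b h →
    subst₂ _<_ (eq a) (eq b) (Equivalence.from (vals a b) h)
    where
    p : ℕ → ℕ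
    p i with i <? k
    ... | yes l = toℕ (e (fromℕ< l))
    ... | no  _ = 0
    p≡ : ∀ {i} (l : i < k) → p i ≡ toℕ (e (fromℕ< l))
    p≡ {i} l with i <? k
    ... | yes l' = cong (toℕ ∘ e) (Fin.fromℕ<-cong i i refl l' l)
    ... | no ¬l = ⊥-elim (¬l l)
    p< : ∀ i → i < k → p i < n
    p< i l = subst (_< n) (sym (p≡ l)) (Fin.toℕ<n _)
    p-asc : ∀ i j → i < j → j < k → p i < p j
    p-asc i j l j< = subst₂ _<_ (sym (p≡ (<-trans l j<))) (sym (p≡ j<))
      (inc-e _ _ (subst₂ _<_ (sym (Fin.toℕ-fromℕ< _)) (sym (Fin.toℕ-fromℕ< _)) l))
    eq : ∀ a → toℕ (lookup v (e a)) ≡ val v (p (toℕ a))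
    eq a = trans (sym (val-lookup v (e a))) (cong (val v) (trans (cong (toℕ ∘ e) (sym (Fin.fromℕ<-toℕ a (Fin.toℕ<n a)))) (sym (p≡ (Fin.toℕ<n a)))))

module _ {n : ℕ} {v : Vec (Fin n) n} where

  Link↑ Link↓ : ℕ → ℕ → Set
  Link↑ a b = a < b × val v a < val v b
  Link↓ a b = a < b × val v b < val v a

  inc-sequence : ∀ {w d l} → Spells v w → Inc↑ w d l →
    Σ[ c ∈ (ℕ → ℕ) ] (∀ i → suc i ≡ d → c i ≡ l) × (∀ i → i < d → c i ∈ w) × (∀ i → suc i < d → Link↑ (c i) (c (suc i)))
  inc-sequence {s ∷ _} sp new = (λ _ → s) , (λ _ _ → refl) , (λ _ _ → here refl) , λ { i (s≤s ()) }
  inc-sequence {s ∷ w} {suc d} ((_ , e) ∷ sp) (ext {l = l} ch l<s) with inc-sequence sp ch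
  ... | c , last , mem , link = snoc c d s , (λ { _ refl → snoc-≡ c d s }) , snoc-all (_∈ s ∷ w) (λ i h → there (mem i h)) (here refl)
      , snoc-step Link↑ link λ i eq → subst (_< s) (sym (last i eq)) l<s ,
          subst (_ <_) (sym e) (proj₂ (spells-∈ sp (mem i (≤-reflexive eq))))
  inc-sequence (_ ∷ sp) (old ch) with inc-sequence sp ch
  ... | c , last , mem , link = c , last , (λ i h → there (mem i h)) , link

  dec-sequence : ∀ {w d x l} → Spells v w → Dec↓ w d x l →
    Σ[ c ∈ (ℕ → ℕ) ] c 0 ≡ l × (∀ i → suc i ≡ d → c i ≡ x) × (∀ i → i < d → c i ∈ w) × (∀ i → suc i < d → Link↓ (c i) (c (suc i)))
  dec-sequence {s ∷ _} sp new = (λ _ → s) , refl , (λ _ _ → refl) , (λ _ _ → here refl) , λ { i (s≤s ()) }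
  dec-sequence (_ ∷ sp) (old ch) with dec-sequence sp ch
  ... | c , h , last , mem , link = c , h , last , (λ i l → there (mem i l)) , link
  dec-sequence {d = suc zero} _ (ext ch _) = ⊥-elim (dec-0 ch)
  dec-sequence {s ∷ w} {suc (suc d)} ((_ , e) ∷ sp) (ext ch s<l) with dec-sequence sp ch
  ... | c , h , last , mem , link = c' , refl , (λ { (suc i) eq → last i (suc-injective eq) }) ,
      (λ { zero _ → here refl ; (suc i) l → there (mem i (s≤s⁻¹ l)) }) ,
      λ { zero _ → subst (s <_) (sym h) s<l , subst (val v (c 0) <_) (sym e) (proj₂ (spells-∈ sp (mem 0 z<s)))
        ; (suc i) l → link i (s≤s⁻¹ l) }
    where
    c' : ℕ → ℕ
    c' zero = s
    c' (suc i) = c i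

  module _ (inj : Injective _≡_ _≡_ (lookup v)) where

    sequence-inc : ∀ {w} → Spells v w → ∀ d (c : ℕ → ℕ) → (∀ i → i ≤ d → c i < n) → (∀ i → i < d → Link↑ (c i) (c (suc i))) →
                   val v (c d) < length w → Inc↑ w (suc d) (c d)
    sequence-inc {x ∷ w} ((x< , e) ∷ sp) d c c< link l with val v (c d) ≟ length w
    ... | no ne = old (sequence-inc sp d c c< link (≤∧≢⇒< (s≤s⁻¹ l) ne))
    ... | yes eq = subst (λ z → Inc↑ (z ∷ w) (suc d) (c d)) (val-inj v inj (c< d ≤-refl) x< (trans eq (sym e))) (go d c< link eq)
      where
      go : ∀ d → (∀ i → i ≤ d → c i < n) → (∀ i → i < d → Link↑ (c i) (c (suc i))) →
           val v (c d) ≡ length w → Inc↑ (c d ∷ w) (suc d) (c d)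
      go zero    c< link eq = new
      go (suc d) c< link eq =
        ext (sequence-inc sp d c (λ i h → c< i (m≤n⇒m≤1+n h)) (λ i h → link i (m<n⇒m<1+n h))
          (subst (val v (c d) <_) eq (proj₂ (link d ≤-refl)))) (proj₁ (link d ≤-refl))

    sequence-dec : ∀ {w} → Spells v w → ∀ d (c : ℕ → ℕ) → (∀ i → i ≤ d → c i < n) → (∀ i → i < d → Link↓ (c i) (c (suc i))) →
                   val v (c 0) < length w → Dec↓ w (suc d) (c d) (c 0)
    sequence-dec {x ∷ w} ((x< , e) ∷ sp) d c c< link l with val v (c 0) ≟ length w
    ... | no ne = old (sequence-dec sp d c c< link (≤∧≢⇒< (s≤s⁻¹ l) ne))
    ... | yes eq = subst (λ z → Dec↓ (z ∷ w) (suc d) (c d) (c 0)) (val-inj v inj (c< 0 z≤n) x< (trans eq (sym e))) (go d c< link)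
      where
      go : ∀ d → (∀ i → i ≤ d → c i < n) → (∀ i → i < d → Link↓ (c i) (c (suc i))) → Dec↓ (c 0 ∷ w) (suc d) (c d) (c 0)
      go zero    c< link = new
      go (suc d) c< link =
        ext (sequence-dec sp d (c ∘ suc) (λ i h → c< (suc i) (s≤s h)) (λ i h → link (suc i) (s≤s h))
          (subst (val v (c 1) <_) eq (proj₂ (link 0 z<s)))) (proj₁ (link 0 z<s))

-- Avoidance of the two patterns as goodness of words

data Position (r : ℕ) : ℕ → ℕ → Set where
  low : ∀ {i} → i < r → Position r i (suc i)
  mid : Position r r (suc (suc r))
  top : Position r (suc r) (suc r)

position-unique : ∀ {r i x z} → Position r i x → Position r i z → x ≡ z
position-unique (low l) (low l') = refl
position-unique (low l) mid = ⊥-elim (<-irrefl refl l)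
position-unique (low l) top = ⊥-elim (<⇒≱ l (n≤1+n _))
position-unique mid (low l) = ⊥-elim (<-irrefl refl l)
position-unique mid mid = refl
position-unique top (low l) = ⊥-elim (<⇒≱ l (n≤1+n _))
position-unique top top = refl

-- `Position` is the graph of the pattern for k = r + 2; comparisons of pattern values become
-- pattern matching on it.
pat12k-position : ∀ r (a : Fin (suc (suc r))) → Position r (toℕ a) (pat12k (suc (suc r)) a)
pat12k-position r a with toℕ a <? r | toℕ a ≟ r
... | yes l | _ = low l
... | no _ | yes eq = subst (λ i → Position r i (suc (suc r))) (sym eq) mid
... | no ¬l | no ne with ≤-antisym (s≤s⁻¹ (Fin.toℕ<n a)) (≤∧≢⇒< (≮⇒≥ ¬l) (ne ∘ sym))
...   | eq = subst (λ i → Position r i (suc r)) (sym eq) top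

pat12k-injective : ∀ r → Injective _≡_ _≡_ (pat12k (suc (suc r)))
pat12k-injective r {a} {b} e = Fin.toℕ-injective (go (pat12k-position r a) (pat12k-position r b) e)
  where
  go : ∀ {i j x y} → Position r i x → Position r j y → x ≡ y → i ≡ j
  go (low l) (low l') refl = refl
  go (low l) mid refl = ⊥-elim (<⇒≱ l (n≤1+n r))
  go (low l) top refl = ⊥-elim (<-irrefl refl l)
  go mid (low l) refl = ⊥-elim (<⇒≱ l (n≤1+n r))
  go mid mid e = refl
  go mid top e = ⊥-elim (1+n≢n e)
  go top (low l) refl = ⊥-elim (<-irrefl refl l)
  go top mid e = ⊥-elim (1+n≢n (sym e))
  go top top e = refl

data Position′ (m : ℕ) : ℕ → ℕ → Set where
  low : ∀ {i} → i < m → Position′ m i (suc (suc i))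
  end : Position′ m m 1

position′-unique : ∀ {m i x z} → Position′ m i x → Position′ m i z → x ≡ z
position′-unique (low l) (low l') = refl
position′-unique (low l) end = ⊥-elim (<-irrefl refl l)
position′-unique end (low l) = ⊥-elim (<-irrefl refl l)
position′-unique end end = refl

pat23k1-position : ∀ m (a : Fin (suc m)) → Position′ m (toℕ a) (pat23k1 (suc m) a)
pat23k1-position m a with toℕ a <? m
... | yes l = low l
... | no ¬l = subst (λ i → Position′ m i 1) (≤-antisym (≮⇒≥ ¬l) (s≤s⁻¹ (Fin.toℕ<n a))) end

pat23k1-injective : ∀ m → Injective _≡_ _≡_ (pat23k1 (suc m))
pat23k1-injective m {a} {b} e = Fin.toℕ-injective (go (pat23k1-position m a) (pat23k1-position m b) e)
  where
  go : ∀ {i j x y} → Position′ m i x → Position′ m j y → x ≡ y → i ≡ j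
  go (low l) (low l') refl = refl
  go end end e = refl

module _ {r₀ n : ℕ} {v : Vec (Fin n) n} (inj : Injective _≡_ _≡_ (lookup v)) where

  private r = suc r₀

  avoids⇒good-E : Avoids v (pat12k (suc (suc r))) → ∀ {w} → Spells v w → E.Good r₀ n w
  avoids⇒good-E av [] = E.[]
  avoids⇒good-E av {s ∷ w} sp₀@((s< , e) ∷ sp) = E.step (avoids⇒good-E av sp) s< (spells-∉ sp₀) λ {y} {l} → bad {y} {l}
    where
    bad : ∀ {y l} → y < n → y ∉ s ∷ w → y < s → Inc↑ w r l → l < y → ⊥
    bad {y} y< y∉ y<s ch l<y with inc-sequence sp ch
    ... | c , last , mem , link = av (contains {v = v} (pat12k-injective r) p p< asc vals)
      where
      c₁ = snoc c r y
      p = snoc c₁ (suc r) s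
      p< : ∀ i → i < suc (suc r) → p i < n
      p< = snoc-all (_< n) (snoc-all (_< n) (λ i h → proj₁ (spells-∈ sp (mem i h))) y<) s<
      asc : ∀ i → suc i < suc (suc r) → p i < p (suc i)
      asc = snoc-step _<_ (snoc-step _<_ (λ i h → proj₁ (link i h)) (λ i eq → subst (_< y) (sym (last i eq)) l<y))
        λ { _ refl → subst (_< s) (sym (snoc-≡ c r y)) y<s }
      p-low : ∀ {i} → i < r → p i ≡ c i
      p-low l = trans (snoc-< c₁ s (m<n⇒m<1+n l)) (snoc-< c y l)
      p-mid : p r ≡ y
      p-mid = trans (snoc-< c₁ s (n<1+n r)) (snoc-≡ c r y)
      p-top : p (suc r) ≡ s
      p-top = snoc-≡ c₁ (suc r) s
      s<y : val v s < val v y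
      s<y = subst (_< val v y) (sym e) (∉-spells inj sp₀ y< y∉)
      c<s : ∀ {i} → i < r → val v (c i) < val v s
      c<s {i} h = subst (val v (c i) <_) (sym e) (proj₂ (spells-∈ sp (mem i h)))
      go : ∀ {i j x z} → Position r i x → Position r j z → x < z → val v (p i) < val v (p j)
      go (low l) (low l') h rewrite p-low l | p-low l' = ascending (val v ∘ c) (λ i h → proj₂ (link i h)) (s≤s⁻¹ h) l'
      go (low l) mid h rewrite p-low l | p-mid = <-trans (c<s l) s<y
      go (low l) top h rewrite p-low l | p-top = c<s l
      go mid (low l) h = ⊥-elim (<-asym (s≤s⁻¹ h) (m<n⇒m<1+n l))
      go mid mid h = ⊥-elim (<-irrefl refl h)
      go mid top h = ⊥-elim (<⇒≱ h (n≤1+n _))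
      go top (low l) h = ⊥-elim (<-asym (s≤s⁻¹ h) l)
      go top mid h rewrite p-mid | p-top = s<y
      go top top h = ⊥-elim (<-irrefl refl h)
      vals : ∀ a b → pat12k (suc (suc r)) a < pat12k (suc (suc r)) b → val v (p (toℕ a)) < val v (p (toℕ b))
      vals a b = go (pat12k-position r a) (pat12k-position r b)

  good⇒avoids-E : ∀ {w} → length w ≡ n → Spells v w → E.Good r₀ n w → Avoids v (pat12k (suc (suc r)))
  good⇒avoids-E {w} len sp g C with occurrence {v = v} C
  ... | p , p< , asc , vals = find sp g (subst (val v s <_) (sym len) (val-< v s<))
    where
    y = p r
    s = p (suc r)
    s< = p< (suc r) ≤-refl
    y< = p< r (m<n⇒m<1+n (n<1+n r))
    vals′ : ∀ {i j x z} → Position r i x → Position r j z → i < suc (suc r) → j < suc (suc r) → x < z → val v (p i) < val v (p j)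
    vals′ {i} {j} P Q i< j< h = subst₂ (λ a b → val v (p a) < val v (p b)) (Fin.toℕ-fromℕ< i<) (Fin.toℕ-fromℕ< j<)
      (vals (fromℕ< i<) (fromℕ< j<) (subst₂ _<_ (same P i<) (same Q j<) h))
      where
      same : ∀ {i x} → Position r i x → (l : i < suc (suc r)) → x ≡ pat12k (suc (suc r)) (fromℕ< l)
      same {i} P l = position-unique P (subst (λ i → Position r i (pat12k (suc (suc r)) (fromℕ< l)))
        (Fin.toℕ-fromℕ< l) (pat12k-position r (fromℕ< l)))
    s<y : val v s < val v y
    s<y = vals′ top mid ≤-refl (m<n⇒m<1+n (n<1+n r)) (n<1+n _)
    link : ∀ i → i < r₀ → Link↑ {v = v} (p i) (p (suc i))
    link i l = asc i (suc i) (n<1+n i) (m<n⇒m<1+n (m<n⇒m<1+n (s≤s l))) ,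
      vals′ (low (m<n⇒m<1+n l)) (low (s≤s l)) (m<n⇒m<1+n (m<n⇒m<1+n (m<n⇒m<1+n l))) (m<n⇒m<1+n (m<n⇒m<1+n (s≤s l))) (n<1+n _)
    -- Go back to the moment when the position of k - 1 is read: the letters of 1 ... k - 2 have
    -- been read by then, and that of k has not.
    find : ∀ {w} → Spells v w → E.Good r₀ n w → val v s < length w → ⊥
    find {x ∷ w} sp₀@((x< , e) ∷ sp) (E.step g _ _ ok) l with val v s ≟ length w
    ... | no ne = find sp g (≤∧≢⇒< (s≤s⁻¹ l) ne)
    ... | yes eq with val-inj v inj s< x< (trans eq (sym e))
    ...   | refl = ok y< (λ m → <⇒≱ s<y (s≤s⁻¹ (subst (λ k → val v y < suc k) (sym eq) (proj₂ (spells-∈ sp₀ m)))))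
              (asc r (suc r) (n<1+n r) ≤-refl)
              (sequence-inc inj sp r₀ p (λ i h → p< i (m<n⇒m<1+n (m<n⇒m<1+n (s≤s h)))) link
                (subst (val v (p r₀) <_) eq (vals′ (low (n<1+n r₀)) top (m<n⇒m<1+n (m<n⇒m<1+n (n<1+n r₀))) ≤-refl ≤-refl)))
              (asc r₀ r (n<1+n r₀) (m<n⇒m<1+n (n<1+n r)))

  avoids⇒good-G : Avoids v (pat23k1 (suc (suc r))) → ∀ {w} → Spells (flip v) w → G.Good r₀ n w
  avoids⇒good-G av [] = G.[]
  avoids⇒good-G av {s ∷ w} sp₀@((s< , e) ∷ sp) = G.step (avoids⇒good-G av sp) s< (spells-∉ sp₀)
    λ {y} {x} {l} y< y∉ ch → ≮⇒≥ λ x<y → bad {y} {x} {l} y< y∉ ch x<y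
    where
    bad : ∀ {y x l} → y < n → y ∉ s ∷ w → Dec↓ (s ∷ w) (suc r) x l → x < y → ⊥
    bad {y} y< y∉ ch x<y with dec-sequence {v = flip v} sp₀ ch
    ... | c , _ , last , mem , link = av (contains {v = v} (pat23k1-injective (suc r)) p p< asc vals)
      where
      p = snoc c (suc r) y
      c< : ∀ i → i < suc r → c i < n
      c< i h = proj₁ (spells-∈ sp₀ (mem i h))
      p< : ∀ i → i < suc (suc r) → p i < n
      p< = snoc-all (_< n) c< y<
      asc : ∀ i → suc i < suc (suc r) → p i < p (suc i)
      asc = snoc-step _<_ (λ i h → proj₁ (link i h)) (λ i eq → subst (_< y) (sym (last i eq)) x<y)
      p-low : ∀ {i} → i < suc r → p i ≡ c i
      p-low l = snoc-< c y l
      p-end : p (suc r) ≡ y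
      p-end = snoc-≡ c (suc r) y
      go : ∀ {i j x z} → Position′ (suc r) i x → Position′ (suc r) j z → x < z → val v (p i) < val v (p j)
      go (low l) (low l') h rewrite p-low l | p-low l' =
        ascending (val v ∘ c) (λ i h → flip-<⁻ v (c< i (<-trans (n<1+n i) h)) (c< (suc i) h) (proj₂ (link i h))) (s≤s⁻¹ (s≤s⁻¹ h)) l'
      go (low l) end (s≤s ())
      go {j = j} end (low l) h rewrite p-low l | p-end =
        flip-<⁻ v y< (c< j l) (<-≤-trans (proj₂ (spells-∈ sp₀ (mem j l))) (∉-spells (flip-injective {v = v} inj) sp₀ y< y∉))
      go end end h = ⊥-elim (<-irrefl refl h)
      vals : ∀ a b → pat23k1 (suc (suc r)) a < pat23k1 (suc (suc r)) b → val v (p (toℕ a)) < val v (p (toℕ b))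
      vals a b = go (pat23k1-position (suc r) a) (pat23k1-position (suc r) b)

  good⇒avoids-G : ∀ {w} → length w ≡ n → Spells (flip v) w → G.Good r₀ n w → Avoids v (pat23k1 (suc (suc r)))
  good⇒avoids-G {w} len sp g C with occurrence {v = v} C
  ... | p , p< , asc , vals = find sp g (subst (val (flip v) (p 0) <_) (sym len) (val-< (flip v) (p< 0 z<s)))
    where
    inj′ = flip-injective {v = v} inj
    y = p (suc r)
    y< = p< (suc r) ≤-refl
    vals′ : ∀ {i j x z} → Position′ (suc r) i x → Position′ (suc r) j z → i < suc (suc r) → j < suc (suc r) → x < z →
            val (flip v) (p j) < val (flip v) (p i)
    vals′ {i} {j} P Q i< j< h = flip-< v (p< i i<) (p< j j<)
      (subst₂ (λ a b → val v (p a) < val v (p b)) (Fin.toℕ-fromℕ< i<) (Fin.toℕ-fromℕ< j<)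
        (vals (fromℕ< i<) (fromℕ< j<) (subst₂ _<_ (same P i<) (same Q j<) h)))
      where
      same : ∀ {i x} → Position′ (suc r) i x → (l : i < suc (suc r)) → x ≡ pat23k1 (suc (suc r)) (fromℕ< l)
      same {i} P l = position′-unique P (subst (λ i → Position′ (suc r) i (pat23k1 (suc (suc r)) (fromℕ< l)))
        (Fin.toℕ-fromℕ< l) (pat23k1-position (suc r) (fromℕ< l)))
    link : ∀ i → i < r → Link↓ {v = flip v} (p i) (p (suc i))
    link i l = asc i (suc i) (n<1+n i) (m<n⇒m<1+n (s≤s l)) ,
      vals′ (low (m<n⇒m<1+n l)) (low (s≤s l)) (m<n⇒m<1+n (m<n⇒m<1+n l)) (m<n⇒m<1+n (s≤s l)) (n<1+n _)
    y>0 : val (flip v) (p 0) < val (flip v) y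
    y>0 = vals′ end (low z<s) ≤-refl z<s (s≤s z<s)
    find : ∀ {w} → Spells (flip v) w → G.Good r₀ n w → val (flip v) (p 0) < length w → ⊥
    find {x ∷ w} sp₀@((x< , e) ∷ sp) (G.step g _ _ ok) l with val (flip v) (p 0) ≟ length w
    ... | no ne = find sp g (≤∧≢⇒< (s≤s⁻¹ l) ne)
    ... | yes eq = <⇒≱ (asc r (suc r) (n<1+n r) ≤-refl)
      (ok y< (λ m → <⇒≱ y>0 (s≤s⁻¹ (subst (λ k → val (flip v) y < suc k) (sym eq) (proj₂ (spells-∈ sp₀ m)))))
        (sequence-dec inj′ sp₀ r p (λ i h → p< i (m<n⇒m<1+n (s≤s h))) link l))

-- The bijection

tr-length : ∀ {ρ γ L ps L' ps'} → Tr ρ γ L ps L' ps' → length L' ≡ length L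
tr-length (row _ _ t) = cong suc (tr-length t)
tr-length (down _ _ _ _ _ _ _ t) = tr-length t
tr-length (jump t) = cong suc (tr-length t)
tr-length end = refl

∅ : ℕ → ℕ
∅ _ = 0

conj-∅ : Conj ∅ ∅
conj-∅ q c = (λ ()) , (λ ())

E-distinct : ∀ {r₀ n w} → E.Good r₀ n w → Distinct n w
E-distinct E.[] = []
E-distinct (E.step g l m _) = (l , m) ∷ E-distinct g

G-distinct : ∀ {r₀ n w} → G.Good r₀ n w → Distinct n w
G-distinct G.[] = []
G-distinct (G.step g l m _) = (l , m) ∷ G-distinct g

module _ {r₀ n : ℕ} where

  -- Goes through the count, since a single cell need not tell whether its letter is used.
  E-filled : ∀ {w L ps} → E.Run r₀ n w L ps → (∀ {y} → y < n → y ∈ w) → Filled L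
  E-filled {w} {L} R all = at-filled L λ y l b →
    <-irrefl (sym (E.counts r₀ n R)) (count-< (λ y → y ∉? w) (blank? L) n y (λ y< m → ⊥-elim (m (all y<)))
      (subst (y <_) (E.run-length r₀ n R) l) b (λ m → m (all (subst (y <_) (E.run-length r₀ n R) l))))

  E-all : ∀ {w L ps} → E.Run r₀ n w L ps → Filled L → ∀ {y} → y < n → y ∈ w
  E-all {w} {L} R f {y} y< = decidable-stable (y ∈? w) λ y∉ →
    <-irrefl (E.counts r₀ n R) (count-< (blank? L) (λ y → y ∉? w) n y (λ z< b → ⊥-elim (nb z< b)) y< y∉ (nb y<))
    where
    nb : ∀ {z} → z < n → at L z ≢ blank
    nb {z} z< = filled-at z f (subst (z <_) (sym (E.run-length r₀ n R)) z<)

  G-filled : ∀ {w L ps} → G.Run r₀ n w L ps → (∀ {y} → y < n → y ∈ w) → Filled L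
  G-filled {w} {L} R all = at-filled L λ y l b →
    G.unused⁻ r₀ n y R b (all (subst (y <_) (G.run-length r₀ n R) l))

  G-all : ∀ {w L ps} → G.Run r₀ n w L ps → Filled L → ∀ {y} → y < n → y ∈ w
  G-all {w} {L} R f {y} y< = decidable-stable (y ∈? w) λ y∉ →
    filled-at y f (subst (y <_) (sym (G.run-length r₀ n R)) y<) (G.unused r₀ n y R y∉)

-- The chain permutation, word, walk, transposed walk, word, permutation. Every link is determined
-- from either side, which gives injectivity and surjectivity at once.
record Linked (r₀ n : ℕ) (π σ : Vec (Fin n) n) : Set where
  field
    {w w'}   : List ℕ
    {L L'}   : Cells
    {ps ps'} : List Step
    spells   : Spells π w
    full     : length w ≡ n
    run      : E.Run r₀ n w L ps
    tr       : Tr ∅ ∅ L ps L' ps'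
    run'     : G.Run r₀ n w' L' ps'
    full'    : length w' ≡ n
    spells'  : Spells (flip σ) w'
open Linked

module _ {r₀ n : ℕ} where

  linked-det : ∀ {π σ τ : Vec (Fin n) n} → IsPerm n π → IsPerm n σ → Linked r₀ n π σ → Linked r₀ n π τ → σ ≡ τ
  linked-det {π} {σ} {τ} i j a b with spells-unique i (spells a) (spells b) (trans (full a) (sym (full b)))
  ... | refl with E.det r₀ n (run a) (run b)
  ...   | refl , refl with tr-det (λ _ → refl) (tr a) (tr b)
  ...     | refl , refl with G.inj r₀ n (run' a) (run' b)
  ...       | refl = trans (sym (flip-flip σ)) (trans
    (cong flip (spells-injective (flip-injective {v = σ} j) (spells' a) (spells' b) (full' a))) (flip-flip τ))

  linked-inj : ∀ {π ω σ : Vec (Fin n) n} → IsPerm n π → IsPerm n σ → Linked r₀ n π σ → Linked r₀ n ω σ → π ≡ ω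
  linked-inj {σ = σ} i j a b
    with spells-unique (flip-injective {v = σ} j) (spells' a) (spells' b) (trans (full' a) (sym (full' b)))
  ... | refl with G.det r₀ n (run' a) (run' b)
  ...   | refl , refl with tr-det (λ _ → refl) (tr-sym (tr a)) (tr-sym (tr b))
  ...     | refl , refl with E.inj r₀ n (run a) (run b)
  ...       | refl = spells-injective i (spells a) (spells b) (full a)

  forth : (π : Av n (pat12k (suc (suc (suc r₀))))) →
          Σ[ σ ∈ Av n (pat23k1 (suc (suc (suc r₀)))) ] Linked r₀ n (proj₁ (proj₁ π)) (proj₁ (proj₁ σ))
  forth ((π , i) , av) with spell i n ≤-refl
  ... | w , sp , len with E.encode r₀ n (avoids⇒good-E i av sp)
  ...   | L , ps , R with tr-exists (E-filled R λ {y} l → ∈-spells i sp l (subst (val π y <_) (sym len) (val-< π l)))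
                       conj-∅ (E.valid r₀ n R)
  ...     | L' , ps' , t , v' , f' with G.decode r₀ n ps' (trans (tr-length t) (E.run-length r₀ n R)) (filled-tidy f') v'
  ...       | w' , R' = ((σ , flip-injective {v = u} inj) , good⇒avoids-G (flip-injective {v = u} inj) len' sp' (G.good r₀ n R')) ,
    record { spells = sp ; full = len ; run = R ; tr = t ; run' = R' ; full' = len' ; spells' = sp' }
    where
    dist = G-distinct (G.good r₀ n R')
    all = G-all R' f'
    len' = distinct-length dist all
    u = unspell w' dist len' all
    inj = unspell-injective w' dist len' all
    -- The word w' lists positions by decreasing value, so the vector spelled by it has to be
    -- complemented.
    σ = flip u
    sp' : Spells (flip σ) w'
    sp' = subst (λ v → Spells v w') (sym (flip-flip u)) (spells-unspell w' dist len' all)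

  back : (σ : Av n (pat23k1 (suc (suc (suc r₀))))) →
         Σ[ π ∈ Av n (pat12k (suc (suc (suc r₀)))) ] Linked r₀ n (proj₁ (proj₁ π)) (proj₁ (proj₁ σ))
  back ((σ , j) , av) with spell (flip-injective {v = σ} j) n ≤-refl
  ... | w' , sp' , len' with G.encode r₀ n (avoids⇒good-G j av sp')
  ...   | L' , ps' , R' with tr-exists (G-filled R' λ {y} l → ∈-spells (flip-injective {v = σ} j) sp' l
                              (subst (val (flip σ) y <_) (sym len') (val-< (flip σ) l))) conj-∅ (G.valid r₀ n R')
  ...     | L , ps , t , v , f with E.decode r₀ n ps (trans (tr-length t) (G.run-length r₀ n R')) (filled-tidy f) v
  ...       | w , R = ((π , inj) , good⇒avoids-E inj len sp (E.good r₀ n R)) ,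
    record { spells = sp ; full = len ; run = R ; tr = tr-sym t ; run' = R' ; full' = len' ; spells' = sp' }
    where
    dist = E-distinct (E.good r₀ n R)
    all = E-all R f
    len = distinct-length dist all
    π = unspell w dist len all
    inj = unspell-injective w dist len all
    sp = spells-unspell w dist len all

descent : ∀ {n} (v : Vec (Fin n) n) i → IsDescent v i → suc i < n × val v (suc i) < val v i
descent v i (j , j' , refl , e , l) = subst (_< _) e (Fin.toℕ<n j') ,
  subst₂ _<_ (trans (sym (val-lookup v j')) (cong (val v) e)) (sym (val-lookup v j)) l

descent⁻ : ∀ {n} (v : Vec (Fin n) n) i → suc i < n → val v (suc i) < val v i → IsDescent v i
descent⁻ v i l h = fromℕ< l₀ , fromℕ< l , Fin.toℕ-fromℕ< l₀ , Fin.toℕ-fromℕ< l ,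
  subst₂ _<_ (val-fromℕ< v l) (val-fromℕ< v l₀) h
  where l₀ = <-trans (n<1+n i) l

-- A descent at i means that suc i precedes i in the word of π but follows i in that of σ. `E-drop`
-- and `G-rise` translate this into `Drop` and `Rise`, which transposition exchanges.
linked-descents : ∀ {r₀ n} {π σ : Vec (Fin n) n} → IsPerm n π → IsPerm n σ → Linked r₀ n π σ →
                  ∀ i → IsDescent σ i ⇔ IsDescent π i
linked-descents {r₀} {n} {π} {σ} ip is a i = mk⇔ to from
  where
  is' = flip-injective {v = σ} is
  mem : suc i < n → suc i ∈ w a
  mem l = ∈-spells ip (spells a) l (subst (val π (suc i) <_) (sym (full a)) (val-< π l))
  mem' : suc i < n → suc i ∈ w' a
  mem' l = ∈-spells is' (spells' a) l (subst (val (flip σ) (suc i) <_) (sym (full' a)) (val-< (flip σ) l))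
  to : IsDescent σ i → IsDescent π i
  to d with descent σ i d
  ... | l , h with G-rise i (run' a) (mem' l)
  ...   | inj₂ (¬b , _) = ⊥-elim (¬b (val-before is' (spells' a) (<-trans (n<1+n i) l) l
            (subst (val (flip σ) (suc i) <_) (sym (full' a)) (val-< (flip σ) l)) (flip-< σ l (<-trans (n<1+n i) l) h)))
  ...   | inj₁ (_ , rise) with E-drop i (run a) (mem l)
  ...     | inj₁ (_ , ¬drop) = ⊥-elim (¬drop (proj₂ (tr-drop conj-∅ (tr a) i) rise))
  ...     | inj₂ (¬b , _) = descent⁻ π i l (≤∧≢⇒< (≮⇒≥ λ h' → ¬b (val-before ip (spells a) (<-trans (n<1+n i) l) l
              (subst (val π (suc i) <_) (sym (full a)) (val-< π l)) h'))
              (1+n≢n ∘ val-inj π ip l (<-trans (n<1+n i) l)))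
  from : IsDescent π i → IsDescent σ i
  from d with descent π i d
  ... | l , h with E-drop i (run a) (mem l)
  ...   | inj₁ (b , _) = ⊥-elim (<-asym h (before-val ip (spells a) b))
  ...   | inj₂ (_ , drop) with G-rise i (run' a) (mem' l)
  ...     | inj₂ (_ , ¬rise) = ⊥-elim (¬rise (proj₁ (tr-drop conj-∅ (tr a) i) drop))
  ...     | inj₁ (b , _) = descent⁻ σ i l (flip-<⁻ σ l (<-trans (n<1+n i) l) (before-val is' (spells' a) b))

-- Stated for arbitrary translations between the two classes, so that those constructed above are never unfolded.
link-bijection : ∀ {r₀ n k} {τ τ' : Fin k → ℕ} →
  (∀ (π : Av n τ) → Σ[ σ ∈ Av n τ' ] Linked r₀ n (proj₁ (proj₁ π)) (proj₁ (proj₁ σ))) →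
  (∀ (σ : Av n τ') → Σ[ π ∈ Av n τ ] Linked r₀ n (proj₁ (proj₁ π)) (proj₁ (proj₁ σ))) →
  Σ (Av n τ → Av n τ') λ Θ →
    (∀ (π σ : Av n τ) → proj₁ (proj₁ (Θ π)) ≡ proj₁ (proj₁ (Θ σ)) → proj₁ (proj₁ π) ≡ proj₁ (proj₁ σ)) ×
    (∀ (σ : Av n τ') → Σ (Av n τ) λ π → proj₁ (proj₁ (Θ π)) ≡ proj₁ (proj₁ σ)) ×
    (∀ (π : Av n τ) (i : ℕ) → IsDescent (proj₁ (proj₁ (Θ π))) i ⇔ IsDescent (proj₁ (proj₁ π)) i)
link-bijection {r₀} {n} {τ = τ} {τ'} f g = Θ , injective , onto , descents
  where
  Θ : Av n τ → Av n τ'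
  Θ π = proj₁ (f π)
  injective : ∀ π σ → proj₁ (proj₁ (Θ π)) ≡ proj₁ (proj₁ (Θ σ)) → proj₁ (proj₁ π) ≡ proj₁ (proj₁ σ)
  injective π σ e = linked-inj (proj₂ (proj₁ π)) (proj₂ (proj₁ (Θ π))) (proj₂ (f π))
    (subst (Linked r₀ n (proj₁ (proj₁ σ))) (sym e) (proj₂ (f σ)))
  onto : ∀ σ → Σ (Av n τ) λ π → proj₁ (proj₁ (Θ π)) ≡ proj₁ (proj₁ σ)
  onto σ with g σ
  ... | π , link = π , linked-det (proj₂ (proj₁ π)) (proj₂ (proj₁ (Θ π))) (proj₂ (f π)) link
  descents : ∀ π i → IsDescent (proj₁ (proj₁ (Θ π))) i ⇔ IsDescent (proj₁ (proj₁ π)) i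
  descents π = linked-descents (proj₂ (proj₁ π)) (proj₂ (proj₁ (Θ π))) (proj₂ (f π))

theorem1 : (k n : ℕ) → 3 ≤ k → 1 ≤ n →
    Σ (Av n (pat12k k) → Av n (pat23k1 k)) λ Θ →
    (∀ (π σ : Av n (pat12k k)) → proj₁ (proj₁ (Θ π)) ≡ proj₁ (proj₁ (Θ σ)) → proj₁ (proj₁ π) ≡ proj₁ (proj₁ σ)) ×
    (∀ (τ : Av n (pat23k1 k)) → Σ (Av n (pat12k k)) λ π → proj₁ (proj₁ (Θ π)) ≡ proj₁ (proj₁ τ)) ×
    (∀ (π : Av n (pat12k k)) (i : ℕ) → IsDescent (proj₁ (proj₁ (Θ π))) i ⇔ IsDescent (proj₁ (proj₁ π)) i)
theorem1 (suc (suc (suc r₀))) n _ _ = link-bijection forth back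
theorem1 (suc (suc zero)) n (s≤s (s≤s ())) _
theorem1 (suc zero) n (s≤s ()) _
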